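{- Let $G_1=(V_1,E_1)$ and $G_2=(V_2,E_2)$ be connected finite simple graphs with disjoint vertex sets, each containing at least one edge, with $|V_i|=n_i$ for $i=1,2$, and set $$B=\left\lceil\frac{n_1n_2}{n_1+n_2-1}\right\rceil-1.$$ Then $$\max\{\operatorname{gscat}(G_1),\operatorname{gscat}(G_2),B\}\leq\operatorname{gscat}(G_1* G_2)\leq\operatorname{gscat}(G_1)+\operatorname{gscat}(G_2)+B+1,$$ where $G_1*G_2$ is the (graph) join of $G_1$ and $G_2$ and $\operatorname{gscat}$ denotes the simplicial geometric category.
   Context: All graphs are finite and simple; all simplicial complexes are finite abstract simplicial complexes. A graph is regarded as a simplicial complex of dimension at most one (its vertices and edges being the simplices) whenever $\operatorname{gscat}$ is applied to it; in particular $G_1*G_2$ below is a graph, regarded as a one-dimensional complex. Join: for graphs $G_1=(V_1,E_1)$ and $G_2=(V_2,E_2)$ with disjoint vertex sets, the join $G_1*G_2$ is the graph with vertex set $V_1\cup V_2$ and edge set $E_1\cup E_2\cup\{uv: u\in V_1,\ v\in V_2\}$. Strong collapse: let $K$ be a simplicial complex and $u\neq v$ vertices of $K$. The vertex $v$ is dominated by $u$ if every maximal simplex of $K$ containing $v$ also contains $u$. In this case, deleting $v$ together with all simplices containing it is called an elementary strong collapse. A strong collapse is a finite sequence of elementary strong collapses. $K$ is strongly collapsible if it strongly collapses to a single vertex (a single vertex is itself strongly collapsible). Simplicial geometric category: $\operatorname{gscat}(K)$ is the least integer $m\geq 0$ such that $K=C_0\cup C_1\cup\cdots\cup C_m$,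 where each $C_i$ is a strongly collapsible subcomplex of $K$. -}

module Defs where

open import Data.Bool using (Bool; true; false; T)
open import Data.Bool.Properties as Bool using (T?)
open import Data.Empty using (⊥-elim)
open import Data.Fin as Fin using (Fin; zero; suc; splitAt)
open import Data.Fin.Properties using (any?; all?)
open import Data.Fin.Subset
  using (Subset; _∈_; _∉_; _⊆_; _∪_; _-_; ⁅_⁆; Nonempty; ∣_∣; inside; outside)
open import Data.Fin.Subset.Properties
  using ( _∈?_; _⊆?_; nonempty?; anySubset?; ⊆-refl; ⊆-trans; ⊆-antisym
        ; x∈⁅x⁆; x∈⁅y⁆⇒x≡y; x∈p∪q⁻; x∈p∪q⁺; x∈p∧x≢y⇒x∈p-y; x∈p⇒∣p-x∣<∣p∣
        ; p─q⊆p; p⊂q⇒∣p∣<∣q∣)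
open import Data.List as List using (List; []; _∷_; length; filter; map; _++_)
open import Data.List.Membership.Propositional using () renaming (_∈_ to _∈ˡ_)
open import Data.List.Membership.Propositional.Properties
  using (∈-filter⁺; ∈-filter⁻; ∈-++⁺ˡ; ∈-++⁺ʳ; ∈-map⁺; ∈-lookup)
open import Data.List.Relation.Unary.Any using (here; there; index)
open import Data.List.Relation.Unary.Any.Properties using (lookup-index)
open import Data.Nat using (ℕ; zero; suc; _+_; _≤_; _<_; z≤n; s≤s)
open import Data.Nat.DivMod using (_/_)
open import Data.Nat.Induction using (<-wellFounded)
open import Data.Product using (∃; ∃₂; _×_; _,_; proj₁; proj₂)
open import Data.Sum using (_⊎_; inj₁; inj₂)
open import Data.Unit using (⊤; tt)
open import Data.Vec using (Vec; []; _∷_; lookup; tabulate; here; there)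
open import Data.Vec.Properties using (≡-dec; lookup∘tabulate; []=⇒lookup; lookup⇒[]=)
open import Function using (_∘_; _on_; case_of_)
open import Induction.WellFounded using (Acc; acc)
open import Level using (Level; 0ℓ) renaming (suc to lsuc)
open import Relation.Binary using (Rel; Symmetric; Irreflexive; DecidableEquality)
import Relation.Binary as B
open import Relation.Binary.Construct.Closure.ReflexiveTransitive using (Star; ε; _◅_)
open import Relation.Binary.PropositionalEquality
  using (_≡_; _≢_; refl; sym; trans; subst)
open import Relation.Nullary using (¬_; Dec; yes; no; does)
open import Relation.Nullary.Decidable
  using (map′; _×-dec_; _⊎-dec_; _→-dec_; ¬?; decidable-stable; dec-true; toWitness; fromWitness; isYes)
open import Relation.Unary using (Pred; Decidable)

private
  variable
    ℓ : Level
    n n₁ n₂ : ℕ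

record Graph (n : ℕ) : Set₁ where
  field
    Adj    : Rel (Fin n) 0ℓ
    adj?   : B.Decidable Adj
    adjSym : Symmetric Adj
    irrefl : Irreflexive _≡_ Adj

open Graph

Connected : Graph n → Set
Connected G = ∀ u v → Star (Adj G) u v

HasEdge : Graph n → Set
HasEdge G = ∃₂ (Adj G)

module _ (G₁ : Graph n₁) (G₂ : Graph n₂) where

  JoinAdj : Rel (Fin n₁ ⊎ Fin n₂) 0ℓ
  JoinAdj (inj₁ u) (inj₁ v) = Adj G₁ u v
  JoinAdj (inj₂ u) (inj₂ v) = Adj G₂ u v
  JoinAdj (inj₁ _) (inj₂ _) = ⊤
  JoinAdj (inj₂ _) (inj₁ _) = ⊤

  private
    joinAdj? : B.Decidable JoinAdj
    joinAdj? (inj₁ u) (inj₁ v) = adj? G₁ u v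
    joinAdj? (inj₂ u) (inj₂ v) = adj? G₂ u v
    joinAdj? (inj₁ _) (inj₂ _) = yes tt
    joinAdj? (inj₂ _) (inj₁ _) = yes tt

    joinSym : Symmetric JoinAdj
    joinSym {inj₁ _} {inj₁ _} e = adjSym G₁ e
    joinSym {inj₂ _} {inj₂ _} e = adjSym G₂ e
    joinSym {inj₁ _} {inj₂ _} _ = tt
    joinSym {inj₂ _} {inj₁ _} _ = tt

    joinIrrefl : Irreflexive _≡_ JoinAdj
    joinIrrefl {inj₁ _} refl e = irrefl G₁ refl e
    joinIrrefl {inj₂ _} refl e = irrefl G₂ refl e

  -- Fin (n₁ + n₂) is the disjoint union of the two vertex sets, via splitAt.
  infixl 6 _✶_
  _✶_ : Graph (n₁ + n₂)
  _✶_ = record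
    { Adj    = JoinAdj on splitAt n₁
    ; adj?   = λ x y → joinAdj? (splitAt n₁ x) (splitAt n₁ y)
    ; adjSym = λ {x} {y} → joinSym {splitAt n₁ x} {splitAt n₁ y}
    ; irrefl = λ { {x} refl → joinIrrefl {splitAt n₁ x} refl }
    }

-- The vertices of a complex are chosen among Fin n, but not every element of
-- Fin n has to be a vertex, so that subcomplexes of K again have type Complex n.

record Complex (n : ℕ) : Set₁ where
  field
    Simplex  : Pred (Subset n) 0ℓ
    simplex? : Decidable Simplex
    nonempty : ∀ {σ} → Simplex σ → Nonempty σ
    face     : ∀ {σ τ} → Simplex σ → τ ⊆ σ → Nonempty τ → Simplex τ

open Complex

Vertex : Complex n → Fin n → Set
Vertex K v = Simplex K ⁅ v ⁆

infix 4 _⊑_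
_⊑_ : Complex n → Complex n → Set
L ⊑ K = ∀ {σ} → Simplex L σ → Simplex K σ

_≟ˢ_ : DecidableEquality (Subset n)
_≟ˢ_ = ≡-dec Bool._≟_

private
  ⁅⁆-nonempty : (v : Fin n) → Nonempty ⁅ v ⁆
  ⁅⁆-nonempty v = v , x∈⁅x⁆ v

  ⁅⁆-⊆ : ∀ {v : Fin n} {σ} → v ∈ σ → ⁅ v ⁆ ⊆ σ
  ⁅⁆-⊆ {v = v} {σ} v∈σ x∈ = subst (_∈ σ) (sym (x∈⁅y⁆⇒x≡y v x∈)) v∈σ

  ⊆⁅⁆ : ∀ {v : Fin n} {τ} → τ ⊆ ⁅ v ⁆ → Nonempty τ → τ ≡ ⁅ v ⁆
  ⊆⁅⁆ {v = v} τ⊆ (x , x∈τ) with refl ← x∈⁅y⁆⇒x≡y v (τ⊆ x∈τ) = ⊆-antisym τ⊆ (⁅⁆-⊆ x∈τ)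

module _ (G : Graph n) where

  GraphSimplex : Pred (Subset n) 0ℓ
  GraphSimplex σ = (∃ λ v → σ ≡ ⁅ v ⁆) ⊎ (∃₂ λ u v → Adj G u v × σ ≡ ⁅ u ⁆ ∪ ⁅ v ⁆)

  private
    graphFace : ∀ {σ τ} → GraphSimplex σ → τ ⊆ σ → Nonempty τ → GraphSimplex τ
    graphFace (inj₁ (v , refl)) τ⊆ ne = inj₁ (v , ⊆⁅⁆ τ⊆ ne)
    graphFace {τ = τ} (inj₂ (u , v , e , refl)) τ⊆ (x , x∈τ) with u ∈? τ | v ∈? τ
    ... | yes u∈τ | yes v∈τ = inj₂ (u , v , e , ⊆-antisym τ⊆ λ y∈ →
          case x∈p∪q⁻ ⁅ u ⁆ ⁅ v ⁆ y∈ of λ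
            { (inj₁ y∈u) → ⁅⁆-⊆ u∈τ y∈u ; (inj₂ y∈v) → ⁅⁆-⊆ v∈τ y∈v })
    ... | no u∉τ | _ = inj₁ (v , ⊆⁅⁆ τ⊆v (x , x∈τ))
      where
      τ⊆v : τ ⊆ ⁅ v ⁆
      τ⊆v {y} y∈ with x∈p∪q⁻ ⁅ u ⁆ ⁅ v ⁆ (τ⊆ y∈)
      ... | inj₁ y∈u = ⊥-elim (u∉τ (subst (_∈ τ) (x∈⁅y⁆⇒x≡y u y∈u) y∈))
      ... | inj₂ y∈v = y∈v
    ... | yes _ | no v∉τ = inj₁ (u , ⊆⁅⁆ τ⊆u (x , x∈τ))
      where
      τ⊆u : τ ⊆ ⁅ u ⁆
      τ⊆u {y} y∈ with x∈p∪q⁻ ⁅ u ⁆ ⁅ v ⁆ (τ⊆ y∈)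
      ... | inj₁ y∈u = y∈u
      ... | inj₂ y∈v = ⊥-elim (v∉τ (subst (_∈ τ) (x∈⁅y⁆⇒x≡y v y∈v) y∈))

    graphNonempty : ∀ {σ} → GraphSimplex σ → Nonempty σ
    graphNonempty (inj₁ (v , refl))         = ⁅⁆-nonempty v
    graphNonempty (inj₂ (u , v , _ , refl)) = u , x∈p∪q⁺ (inj₁ (x∈⁅x⁆ u))

  toComplex : Complex n
  toComplex = record
    { Simplex  = GraphSimplex
    ; simplex? = λ σ → any? (λ v → σ ≟ˢ ⁅ v ⁆)
                 ⊎-dec any? (λ u → any? λ v → adj? G u v ×-dec (σ ≟ˢ (⁅ u ⁆ ∪ ⁅ v ⁆)))
    ; nonempty = graphNonempty
    ; face     = graphFace
    }

Maximal : Complex n → Subset n → Set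
Maximal K σ = Simplex K σ × (∀ τ → Simplex K τ → σ ⊆ τ → τ ≡ σ)

record Dominated (K : Complex n) (v u : Fin n) : Set where
  field
    distinct  : u ≢ v
    v-vertex   : Vertex K v
    u-vertex   : Vertex K u
    dominates : ∀ σ → Maximal K σ → v ∈ σ → u ∈ σ

delete : Complex n → Fin n → Complex n
delete K v = record
  { Simplex  = λ σ → Simplex K σ × v ∉ σ
  ; simplex? = λ σ → simplex? K σ ×-dec ¬? (v ∈? σ)
  ; nonempty = nonempty K ∘ proj₁
  ; face     = λ (s , v∉σ) τ⊆σ ne → face K s τ⊆σ ne , v∉σ ∘ τ⊆σ
  }

infix 4 _↘ᵉ_ _↘↘_
data _↘ᵉ_ {n} (K : Complex n) : Complex n → Set₁ where
  collapse : ∀ {v u} → Dominated K v u → K ↘ᵉ delete K v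

_↘↘_ : Rel (Complex n) (lsuc 0ℓ)
_↘↘_ = Star _↘ᵉ_

IsVertex : Complex n → Set
IsVertex K = ∃ λ v → Vertex K v × (∀ σ → Simplex K σ → σ ≡ ⁅ v ⁆)

StronglyCollapsible : Complex n → Set₁
StronglyCollapsible K = ∃ λ L → K ↘↘ L × IsVertex L

record Cover (K : Complex n) (m : ℕ) : Set₁ where
  field
    piece       : Fin (suc m) → Complex n
    subcomplex  : ∀ i → piece i ⊑ K
    collapsible : ∀ i → StronglyCollapsible (piece i)
    covers      : ∀ σ → Simplex K σ → ∃ λ i → Simplex (piece i) σ

IsGscat : Complex n → ℕ → Set₁
IsGscat K m = Cover K m × (∀ k → Cover K k → m ≤ k)

-- The lemmas up to existsGscat show that a complex with at least one simplex
-- has a least m with Cover K m: having such a cover is decidable, and the full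
-- simplices contained in K form one.

private
  allSubset? : {P : Pred (Subset n) ℓ} → Decidable P → Dec (∀ σ → P σ)
  allSubset? P? = map′
    (λ ¬∃ σ → decidable-stable (P? σ) λ ¬p → ¬∃ (σ , ¬p))
    (λ ∀p (σ , ¬p) → ¬p (∀p σ))
    (¬? (anySubset? (¬? ∘ P?)))

  maximal? : (K : Complex n) → Decidable (Maximal K)
  maximal? K σ = simplex? K σ ×-dec
    allSubset? (λ τ → simplex? K τ →-dec ((σ ⊆? τ) →-dec (τ ≟ˢ σ)))

  dominated? : (K : Complex n) → ∀ v u → Dec (Dominated K v u)
  dominated? K v u = map′
    (λ (d , a , b , c) → record { distinct = d ; v-vertex = a ; u-vertex = b ; dominates = c })
    (λ d → let open Dominated d in distinct , v-vertex , u-vertex , dominates)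
    (¬? (u Fin.≟ v) ×-dec simplex? K ⁅ v ⁆ ×-dec simplex? K ⁅ u ⁆
      ×-dec allSubset? (λ σ → maximal? K σ →-dec ((v ∈? σ) →-dec (u ∈? σ))))

  isVertex? : (K : Complex n) → Dec (IsVertex K)
  isVertex? K = any? λ v → simplex? K ⁅ v ⁆ ×-dec
    allSubset? (λ σ → simplex? K σ →-dec (σ ≟ˢ ⁅ v ⁆))

  vertices : Complex n → Subset n
  vertices K = tabulate λ v → does (simplex? K ⁅ v ⁆)

  ∈-vertices⁺ : ∀ (K : Complex n) {v} → Vertex K v → v ∈ vertices K
  ∈-vertices⁺ K {v} s = lookup⇒[]= v _
    (trans (lookup∘tabulate _ v) (dec-true (simplex? K ⁅ v ⁆) s))

  ∈-vertices⁻ : ∀ (K : Complex n) {v} → v ∈ vertices K → Vertex K v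
  ∈-vertices⁻ K {v} v∈
    with simplex? K ⁅ v ⁆
       | trans (sym (lookup∘tabulate (λ w → does (simplex? K ⁅ w ⁆)) v)) ([]=⇒lookup v∈)
  ... | yes s | _  = s
  ... | no _  | ()

  delete-vertices : ∀ (K : Complex n) {v} → Vertex K v →
                    ∣ vertices (delete K v) ∣ < ∣ vertices K ∣
  delete-vertices K {v} s = p⊂q⇒∣p∣<∣q∣
    ( (λ x∈ → ∈-vertices⁺ K (proj₁ (∈-vertices⁻ (delete K v) x∈)))
    , v , ∈-vertices⁺ K s
    , λ v∈ → proj₂ (∈-vertices⁻ (delete K v) v∈) (x∈⁅x⁆ v))

  stronglyCollapsible? : (K : Complex n) → Dec (StronglyCollapsible K)
  stronglyCollapsible? {n} K = go K (<-wellFounded _)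
    where
    step? : (K : Complex n) → Acc _<_ ∣ vertices K ∣ → ∀ v u →
            Dec (Dominated K v u × StronglyCollapsible (delete K v))
    go : (K : Complex n) → Acc _<_ ∣ vertices K ∣ → Dec (StronglyCollapsible K)
    go K a = map′
      (λ { (inj₁ p)                               → K , ε , p
         ; (inj₂ (_ , _ , d , (L , K↘L , p))) → L , collapse d ◅ K↘L , p })
      (λ { (_ , ε , p)                  → inj₁ p
         ; (L , collapse d ◅ K↘L , p) → inj₂ (_ , _ , d , (L , K↘L , p)) })
      (isVertex? K ⊎-dec any? λ v → any? λ u → step? K a v u)
    step? K (acc rs) v u with dominated? K v u
    ... | no ¬d = no (¬d ∘ proj₁)
    ... | yes d = map′ (d ,_) proj₂
                    (go (delete K v) (rs (delete-vertices K (Dominated.v-vertex d))))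

  infix 4 _≐_
  _≐_ : Complex n → Complex n → Set
  K ≐ L = K ⊑ L × L ⊑ K

  maximal-resp : {K L : Complex n} → K ≐ L → ∀ {σ} → Maximal K σ → Maximal L σ
  maximal-resp (K⊑L , L⊑K) (s , max) = K⊑L s , λ τ t → max τ (L⊑K t)

  dominated-resp : {K L : Complex n} → K ≐ L → ∀ {v u} → Dominated K v u → Dominated L v u
  dominated-resp {K = K} {L} (K⊑L , L⊑K) d = record
    { distinct = distinct ; v-vertex = K⊑L v-vertex ; u-vertex = K⊑L u-vertex
    ; dominates = λ σ max → dominates σ (maximal-resp {K = L} {K} (L⊑K , K⊑L) max) }
    where open Dominated d

  stronglyCollapsible-resp : {K L : Complex n} → K ≐ L →
                             StronglyCollapsible K → StronglyCollapsible L
  stronglyCollapsible-resp {L = L} (K⊑L , L⊑K) (_ , ε , v , s , p) =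
    L , ε , v , K⊑L s , λ σ → p σ ∘ L⊑K
  stronglyCollapsible-resp {K = K} {L} K≐L@(K⊑L , L⊑K) (M , collapse {v = v} d ◅ K↘M , p) =
    let d′ = dominated-resp {K = K} {L} K≐L d
        (M′ , L↘M′ , p′) = stronglyCollapsible-resp {K = delete K v} {delete L v}
          ((λ (s , v∉) → K⊑L s , v∉) , (λ (s , v∉) → L⊑K s , v∉)) (M , K↘M , p)
    in M′ , collapse d′ ◅ L↘M′ , p′

  fullSimplex : Subset n → Complex n
  fullSimplex σ = record
    { Simplex  = λ τ → Nonempty τ × τ ⊆ σ
    ; simplex? = λ τ → nonempty? τ ×-dec (τ ⊆? σ)
    ; nonempty = proj₁
    ; face     = λ (_ , τ⊆σ) ρ⊆τ ne → ne , ⊆-trans ρ⊆τ τ⊆σ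
    }

  ∉- : ∀ (σ : Subset n) v → v ∉ σ - v
  ∉- (_ ∷ σ)       zero    ()
  ∉- (inside ∷ σ)  (suc v) (there v∈) = ∉- σ v v∈
  ∉- (outside ∷ σ) (suc v) (there v∈) = ∉- σ v v∈

  fullSimplex-collapsible : (σ : Subset n) → Nonempty σ → StronglyCollapsible (fullSimplex σ)
  fullSimplex-collapsible σ = go σ (<-wellFounded _)
    where
    go : (σ : Subset n) → Acc _<_ ∣ σ ∣ → Nonempty σ → StronglyCollapsible (fullSimplex σ)
    go σ (acc rs) (v , v∈σ) with any? (λ u → (u ∈? σ) ×-dec ¬? (u Fin.≟ v))
    ... | no none = fullSimplex σ , ε , v , (⁅⁆-nonempty v , ⁅⁆-⊆ v∈σ) , λ τ (ne , τ⊆σ) →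
          ⊆⁅⁆ (λ {x} x∈τ → subst (_∈ ⁅ v ⁆)
                (sym (decidable-stable (x Fin.≟ v) λ x≢v → none (x , τ⊆σ x∈τ , x≢v)))
                (x∈⁅x⁆ v)) ne
    ... | yes (u , u∈σ , u≢v) =
          let (L , ↘L , p) = stronglyCollapsible-resp {K = fullSimplex (σ - v)} {delete (fullSimplex σ) v}
                ( (λ (ne , τ⊆) → (ne , ⊆-trans τ⊆ (p─q⊆p σ ⁅ v ⁆)) , λ v∈τ → ∉- σ v (τ⊆ v∈τ))
                , (λ {τ} ((ne , τ⊆) , v∉τ) → ne , λ x∈τ →
                     x∈p∧x≢y⇒x∈p-y (τ⊆ x∈τ) λ x≡v → v∉τ (subst (_∈ τ) x≡v x∈τ)))
                (go (σ - v) (rs (x∈p⇒∣p-x∣<∣p∣ v∈σ)) (u , x∈p∧x≢y⇒x∈p-y u∈σ u≢v))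
          in L , collapse d ◅ ↘L , p
      where
      d : Dominated (fullSimplex σ) v u
      d = record
        { distinct  = u≢v
        ; v-vertex   = ⁅⁆-nonempty v , ⁅⁆-⊆ v∈σ
        ; u-vertex   = ⁅⁆-nonempty u , ⁅⁆-⊆ u∈σ
        ; dominates = λ τ ((_ , τ⊆σ) , max) _ →
            subst (u ∈_) (max σ ((v , v∈σ) , ⊆-refl) τ⊆σ) u∈σ
        }

  allSubsets : ∀ n → List (Subset n)
  allSubsets zero    = [] ∷ []
  allSubsets (suc n) = map (inside ∷_) (allSubsets n) ++ map (outside ∷_) (allSubsets n)

  ∈-allSubsets : (σ : Subset n) → σ ∈ˡ allSubsets n
  ∈-allSubsets []            = here refl
  ∈-allSubsets (inside ∷ σ)  = ∈-++⁺ˡ (∈-map⁺ (inside ∷_) (∈-allSubsets σ))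
  ∈-allSubsets (outside ∷ σ) =
    ∈-++⁺ʳ (map (inside ∷_) (allSubsets _)) (∈-map⁺ (outside ∷_) (∈-allSubsets σ))

  someCover : (K : Complex n) → ∃ (Simplex K) → ∃ (Cover K)
  someCover {n} K (σ₀ , s₀) = length simplices , record
    { piece       = fullSimplex ∘ σ
    ; subcomplex  = λ i (ne , τ⊆) → face K (simplex i) τ⊆ ne
    ; collapsible = λ i → fullSimplex-collapsible (σ i) (nonempty K (simplex i))
    ; covers      = λ τ t →
        let τ∈ = ∈-filter⁺ (simplex? K) (∈-allSubsets τ) t
        in suc (index τ∈) , nonempty K t , subst (τ ⊆_) (lookup-index τ∈) ⊆-refl
    }
    where
    simplices : List (Subset n)
    simplices = filter (simplex? K) (allSubsets n)

    σ : Fin (suc (length simplices)) → Subset n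
    σ = List.lookup (σ₀ ∷ simplices)

    simplex : ∀ i → Simplex K (σ i)
    simplex zero    = s₀
    simplex (suc i) =
      proj₂ (∈-filter⁻ (simplex? K) {xs = allSubsets n} (∈-lookup {xs = simplices} i))

  Searchable : Set → Set₂
  Searchable A = {P : Pred A (lsuc 0ℓ)} → Decidable P → Dec (∃ P)

  Bool-searchable : Searchable Bool
  Bool-searchable P? = map′
    (λ { (inj₁ p) → true , p ; (inj₂ p) → false , p })
    (λ { (true , p) → inj₁ p ; (false , p) → inj₂ p })
    (P? true ⊎-dec P? false)

  ×-searchable : ∀ {A B} → Searchable A → Searchable B → Searchable (A × B)
  ×-searchable sA sB P? = map′
    (λ (a , b , p) → (a , b) , p) (λ ((a , b) , p) → a , b , p)
    (sA λ a → sB λ b → P? (a , b))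

  Vec-searchable : ∀ {A} → Searchable A → ∀ m → Searchable (Vec A m)
  Vec-searchable sA zero    P? = map′ ([] ,_) (λ { ([] , p) → p }) (P? [])
  Vec-searchable sA (suc m) P? = map′
    (λ (a , as , p) → (a ∷ as) , p) (λ { ((a ∷ as) , p) → a , as , p })
    (sA λ a → Vec-searchable sA m λ as → P? (a ∷ as))

  Table : ℕ → Set
  Table zero    = Bool
  Table (suc n) = Table n × Table n

  Table-searchable : ∀ n → Searchable (Table n)
  Table-searchable zero    = Bool-searchable
  Table-searchable (suc n) = ×-searchable (Table-searchable n) (Table-searchable n)

  eval : Table n → Subset n → Bool
  eval t       []            = t
  eval (t , _) (inside ∷ σ)  = eval t σ
  eval (_ , t) (outside ∷ σ) = eval t σ

  table : (Subset n → Bool) → Table n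
  table {zero}  f = f []
  table {suc n} f = table (f ∘ (inside ∷_)) , table (f ∘ (outside ∷_))

  eval-table : ∀ (f : Subset n → Bool) σ → eval (table f) σ ≡ f σ
  eval-table f []            = refl
  eval-table f (inside ∷ σ)  = eval-table (f ∘ (inside ∷_)) σ
  eval-table f (outside ∷ σ) = eval-table (f ∘ (outside ∷_)) σ

  generated : Table n → Complex n
  generated t = record
    { Simplex  = λ τ → Nonempty τ × ∃ λ σ → T (eval t σ) × τ ⊆ σ
    ; simplex? = λ τ → nonempty? τ ×-dec anySubset? (λ σ → T? (eval t σ) ×-dec (τ ⊆? σ))
    ; nonempty = proj₁
    ; face     = λ (_ , σ , tσ , τ⊆σ) ρ⊆τ ne → ne , σ , tσ , ⊆-trans ρ⊆τ τ⊆σ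
    }

  tableOf : Complex n → Table n
  tableOf K = table (isYes ∘ simplex? K)

  generated-tableOf : (K : Complex n) → K ≐ generated (tableOf K)
  generated-tableOf K =
      (λ {σ} s → nonempty K s , σ
               , subst T (sym (eval-table _ σ)) (fromWitness {a? = simplex? K σ} s) , ⊆-refl)
    , (λ (ne , σ , tσ , τ⊆σ) →
         face K (toWitness {a? = simplex? K σ} (subst T (eval-table _ σ) tσ)) τ⊆σ ne)

  cover? : (K : Complex n) → Decidable (Cover K)
  cover? {n} K m = map′
    (λ (ts , sub , coll , cov) → record
      { piece = generated ∘ lookup ts ; subcomplex = λ i {σ} → sub i σ
      ; collapsible = coll ; covers = cov })
    (λ c → let open Cover c
               ts = tabulate (tableOf ∘ piece)
               eq : ∀ i → piece i ≐ generated (lookup ts i)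
               eq i = subst (λ t → piece i ≐ generated t)
                        (sym (lookup∘tabulate (tableOf ∘ piece) i)) (generated-tableOf (piece i))
           in ts
            , (λ i σ s → subcomplex i (proj₂ (eq i) s))
            , (λ i → stronglyCollapsible-resp {K = piece i} (eq i) (collapsible i))
            , (λ σ s → let (i , s′) = covers σ s in i , proj₁ (eq i) s′))
    (Vec-searchable (Table-searchable n) (suc m) λ ts →
      all? (λ i → allSubset? λ σ → simplex? (generated (lookup ts i)) σ →-dec simplex? K σ)
      ×-dec all? (λ i → stronglyCollapsible? (generated (lookup ts i)))
      ×-dec allSubset? (λ σ → simplex? K σ →-dec any? λ i → simplex? (generated (lookup ts i)) σ))

  least : {P : Pred ℕ ℓ} → Decidable P → ∀ n → P n → ∃ λ m → P m × (∀ k → P k → m ≤ k)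
  least P? n p with P? 0
  ... | yes p₀ = 0 , p₀ , λ _ _ → z≤n
  least P? zero    p | no ¬p₀ = ⊥-elim (¬p₀ p)
  least P? (suc n) p | no ¬p₀ =
    let (m , pm , min) = least (P? ∘ suc) n p
    in suc m , pm , λ { zero q → ⊥-elim (¬p₀ q) ; (suc k) q → s≤s (min k q) }

opaque
  existsGscat : (K : Complex n) → ∃ (Simplex K) → ∃ (IsGscat K)
  existsGscat K ne = let (m , c) = someCover K ne in least (cover? K) m c

-- The empty complex has no cover; its value 0 is a dummy.  On every other complex
-- the value is pinned down by gscat-isGscat.
gscat : Complex n → ℕ
gscat K with anySubset? (simplex? K)
... | yes ne = proj₁ (existsGscat K ne)
... | no  _  = 0

gscat-isGscat : (K : Complex n) → ∃ (Simplex K) → IsGscat K (gscat K)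
gscat-isGscat K ne with anySubset? (simplex? K)
... | yes ne′ = proj₂ (existsGscat K ne′)
... | no  ¬ne = ⊥-elim (¬ne ne)

-- The value 0 for a zero divisor is a dummy; with divisor suc b the ceiling is
-- ⌊ (a + (suc b - 1)) / suc b ⌋.
⌈_/_⌉ : ℕ → ℕ → ℕ
⌈ a / zero  ⌉ = 0
⌈ a / suc b ⌉ = (a + b) / suc b

{-# OPTIONS --safe #-}
-- For a connected graph, gscat + 1 is the least number of forests covering the edges:
-- a strongly collapsible subcomplex is a tree, and every forest extends to a spanning tree.
-- A forest on the join restricts to each Gᵢ, and it has at most n₁ + n₂ - 1 edges, of
-- which all n₁ n₂ cross edges must be covered; this gives the lower bounds.  For the upper
-- bound, the disjoint union of a forest of G₁ and a forest of G₂ is a forest, so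
-- g₁ + g₂ + 1 forests cover both graphs, and ⌈ n₁ n₂ / (n₁ + n₂ - 1) ⌉ lattice paths
-- wrapped around a torus cover the complete bipartite graph.
module Submission where

open import Defs
open Graph
open Complex
open import Data.Empty using (⊥)
open import Data.Fin as Fin
  using (Fin; toℕ; fromℕ<; splitAt; join; _↑ˡ_; _↑ʳ_; punchOut; combine; remQuot)
open import Data.Fin.Properties
  using ( any?; toℕ<n; toℕ-injective; toℕ-fromℕ<; splitAt-↑ˡ; splitAt-↑ʳ; splitAt-join
        ; join-splitAt; ↑ˡ-injective; ↑ʳ-injective; punchOut-injective; combine-injective
        ; combine-remQuot; injective⇒≤)
  renaming (_≟_ to _≟ᶠ_)
open import Data.Fin.Subset
  using (Subset; _∈_; _∉_; _⊆_; _∪_; _-_; ⁅_⁆; Nonempty; ∣_∣; inside; outside)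
  renaming (⊤ to full)
open import Data.Fin.Subset.Properties
  using ( _∈?_; ⊆-antisym; ∈⊤; x∈⁅x⁆; x∈⁅y⁆⇒x≡y; x∈p∪q⁻; x∈p∪q⁺; x∈p∧x≢y⇒x∈p-y
        ; x∈p⇒∣p-x∣<∣p∣; p─q⊆p; ∪-comm)
open import Data.List using (List; []; _∷_; allFin; cartesianProduct; filter)
open import Data.List.Membership.Propositional using () renaming (_∈_ to _∈ˡ_)
open import Data.List.Membership.Propositional.Properties
  using (∈-allFin; ∈-cartesianProduct⁺; ∈-filter⁺)
open import Data.List.Relation.Unary.All as All using ()
open import Data.List.Relation.Unary.All.Properties using (all-filter)
open import Data.List.Relation.Unary.Any using (here; there)
open import Data.Nat
  using ( ℕ; zero; suc; _+_; _*_; _∸_; _⊔_; _≤_; _<_; z≤n; s≤s; s≤s⁻¹; z<s; NonZero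
        ; >-nonZero; >-nonZero⁻¹; _<?_; _≤?_)
open import Data.Nat.DivMod
open import Data.Nat.Divisibility using (n∣m*n)
open import Data.Nat.Induction using (<-wellFounded)
open import Data.Nat.Properties hiding (_≟_)
open import Data.List.Extrema ≤-totalOrder using (argmax; argmax-all; f[xs]≤f[argmax])
open import Data.Product using (∃; ∃₂; _×_; _,_; proj₁; proj₂)
open import Data.Sum as Sum using (_⊎_; inj₁; inj₂)
open import Data.Unit using (⊤; tt)
open import Data.Vec using (_∷_; here; there)
open import Function using (_∘_; id; _on_; case_of_)
open import Induction.WellFounded using (Acc; acc)
open import Level using (0ℓ)
open import Relation.Binary using (Rel; Symmetric)
open import Relation.Binary.Construct.Closure.ReflexiveTransitive using (Star; ε; _◅_)
open import Relation.Binary.PropositionalEquality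
open import Relation.Nullary using (¬_; Dec; yes; no; contradiction)
open import Relation.Nullary.Decidable using (decidable-stable; ¬?; _×-dec_; _⊎-dec_)
open import Relation.Unary using (Pred; Decidable)

private
  variable
    n n₁ n₂ : ℕ

-- Rooted forests

-- Roots are the fixed points of parent; rank excludes cycles.
record Forest (V : Set) : Set where
  field
    parent   : V → V
    rank     : V → ℕ
    descends : ∀ v → parent v ≢ v → rank (parent v) < rank v

open Forest

-- A root is linked to itself, so statements about genuine edges carry an extra `u ≢ v`.
Link : {V : Set} → Forest V → Rel V 0ℓ
Link F u v = parent F u ≡ v ⊎ parent F v ≡ u

ParentEdgesIn : {V : Set} → Rel V 0ℓ → Forest V → Set
ParentEdgesIn R F = ∀ v → parent F v ≢ v → R v (parent F v)

infix 4 _≼_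
-- Compares undirected edge sets: `F′` may orient an edge of `F` the other way, so rerooting moves
-- within an equivalence class.
_≼_ : {V : Set} → Rel (Forest V) 0ℓ
F ≼ F′ = ParentEdgesIn (Link F′) F

link-sym : {V : Set} (F : Forest V) → Symmetric (Link F)
link-sym F = Sum.swap

parentEdgesIn-link : {V : Set} {R : Rel V 0ℓ} (F : Forest V) → Symmetric R →
                     ParentEdgesIn R F → ∀ {u v} → u ≢ v → Link F u v → R u v
parentEdgesIn-link F symR s u≢v (inj₁ refl) = s _ (u≢v ∘ sym)
parentEdgesIn-link F symR s u≢v (inj₂ refl) = symR (s _ u≢v)

≼-parentEdgesIn : {V : Set} {R : Rel V 0ℓ} (F F′ : Forest V) → Symmetric R →
                  F′ ≼ F → ParentEdgesIn R F → ParentEdgesIn R F′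
≼-parentEdgesIn F F′ symR F′≼F s v pv≢v =
  parentEdgesIn-link F symR s (pv≢v ∘ sym) (F′≼F v pv≢v)

≼-trans : {V : Set} (F F′ F″ : Forest V) → F ≼ F′ → F′ ≼ F″ → F ≼ F″
≼-trans F F′ F″ p q = ≼-parentEdgesIn F′ F (link-sym F″) p q

≼-refl : {V : Set} (F : Forest V) → F ≼ F
≼-refl F v _ = inj₁ refl

climb : Forest (Fin n) → ℕ → Fin n → Fin n
climb F zero    v = v
climb F (suc k) v = climb F k (parent F v)

climb-root : ∀ (F : Forest (Fin n)) k {v} → parent F v ≡ v → climb F k v ≡ v
climb-root F zero    pv≡v = refl
climb-root F (suc k) pv≡v = trans (cong (climb F k) pv≡v) (climb-root F k pv≡v)

climb-isRoot : ∀ (F : Forest (Fin n)) k v → rank F v ≤ k →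
               parent F (climb F k v) ≡ climb F k v
climb-isRoot F k v r≤k with parent F v ≟ᶠ v
climb-isRoot F k       v r≤k | yes pv≡v rewrite climb-root F k pv≡v = pv≡v
climb-isRoot F zero    v r≤k | no pv≢v  = contradiction (<-≤-trans (descends F v pv≢v) r≤k) n≮0
climb-isRoot F (suc k) v r≤k | no pv≢v  =
  climb-isRoot F k (parent F v) (s≤s⁻¹ (<-≤-trans (descends F v pv≢v) r≤k))

-- A root absorbs any further climbing, and the rank bounds the number of steps to it, so all
-- sufficient amounts of fuel agree.
climb-stable : ∀ (F : Forest (Fin n)) j k v → rank F v ≤ j → rank F v ≤ k →
               climb F j v ≡ climb F k v
climb-stable F j k v r≤j r≤k with parent F v ≟ᶠ v
... | yes pv≡v = trans (climb-root F j pv≡v) (sym (climb-root F k pv≡v))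
climb-stable F zero    k       v r≤j r≤k | no pv≢v =
  contradiction (<-≤-trans (descends F v pv≢v) r≤j) n≮0
climb-stable F (suc j) zero    v r≤j r≤k | no pv≢v =
  contradiction (<-≤-trans (descends F v pv≢v) r≤k) n≮0
climb-stable F (suc j) (suc k) v r≤j r≤k | no pv≢v =
  climb-stable F j k (parent F v) (s≤s⁻¹ (<-≤-trans d r≤j)) (s≤s⁻¹ (<-≤-trans d r≤k))
  where d = descends F v pv≢v

root : Forest (Fin n) → Fin n → Fin n
root F v = climb F (rank F v) v

root-isRoot : ∀ (F : Forest (Fin n)) v → parent F (root F v) ≡ root F v
root-isRoot F v = climb-isRoot F (rank F v) v ≤-refl

isRoot⇒root : ∀ (F : Forest (Fin n)) {v} → parent F v ≡ v → root F v ≡ v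
isRoot⇒root F = climb-root F (rank F _)

root-parent : ∀ (F : Forest (Fin n)) v → root F (parent F v) ≡ root F v
root-parent F v with parent F v ≟ᶠ v
... | yes pv≡v = cong (root F) pv≡v
... | no pv≢v  = trans
  (climb-stable F (rank F (parent F v)) (rank F v) (parent F v) ≤-refl (<⇒≤ (descends F v pv≢v)))
  (climb-stable F (suc (rank F v)) (rank F v) v (n≤1+n _) ≤-refl)

root-link : ∀ (F : Forest (Fin n)) {u v} → Link F u v → root F u ≡ root F v
root-link F (inj₁ refl) = sym (root-parent F _)
root-link F (inj₂ refl) = root-parent F _

root-climb : ∀ (F F′ : Forest (Fin n)) → F ≼ F′ → ∀ k v → root F′ (climb F k v) ≡ root F′ v
root-climb F F′ F≼F′ zero    v = refl
root-climb F F′ F≼F′ (suc k) v with parent F v ≟ᶠ v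
... | yes pv≡v = trans (root-climb F F′ F≼F′ k (parent F v)) (cong (root F′) pv≡v)
... | no pv≢v  =
  trans (root-climb F F′ F≼F′ k (parent F v)) (sym (root-link F′ (F≼F′ v pv≢v)))

-- Equal roots mean equal components. Every step of a climb in `F` runs along an edge of `F′`, so
-- components can only grow.
root-mono : ∀ (F F′ : Forest (Fin n)) → F ≼ F′ → ∀ {u v} →
            root F u ≡ root F v → root F′ u ≡ root F′ v
root-mono F F′ F≼F′ {u} {v} eq = begin
  root F′ u           ≡⟨ root-climb F F′ F≼F′ (rank F u) u ⟨
  root F′ (root F u)  ≡⟨ cong (root F′) eq ⟩
  root F′ (root F v)  ≡⟨ root-climb F F′ F≼F′ (rank F v) v ⟩
  root F′ v           ∎
  where open ≡-Reasoning

-- Rerooting, merging and spanning trees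

infixl 8 _[_≔_]
_[_≔_] : {A : Set} → (Fin n → A) → Fin n → A → Fin n → A
(f [ x ≔ a ]) z with z ≟ᶠ x
... | yes _ = a
... | no  _ = f z

≔-same : {A : Set} (f : Fin n → A) (x : Fin n) {a : A} → (f [ x ≔ a ]) x ≡ a
≔-same f x with x ≟ᶠ x
... | yes _  = refl
... | no x≢x = contradiction refl x≢x

≔-other : {A : Set} (f : Fin n → A) {x z : Fin n} {a : A} → z ≢ x → (f [ x ≔ a ]) z ≡ f z
≔-other f {x} {z} z≢x with z ≟ᶠ x
... | yes z≡x = contradiction z≡x z≢x
... | no _    = refl

-- Exchanges a root with its child y.
swapRoot : (F : Forest (Fin n)) (y : Fin n) →
           parent F (parent F y) ≡ parent F y → parent F y ≢ y →
           ∃ λ F′ → F ≼ F′ × F′ ≼ F × parent F′ y ≡ y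
swapRoot {n} F y ppy≡py py≢y = F′ , F≼F′ , F′≼F , parent-y
  where
  ρ = parent F y
  parent′ : Fin n → Fin n
  parent′ = parent F [ ρ ≔ y ] [ y ≔ y ]
  -- `y` drops to the bottom and every other rank goes up by one, which puts both the old root and
  -- the children of `y` above `y`.
  rank′ : Fin n → ℕ
  rank′ = (suc ∘ rank F) [ y ≔ 0 ]

  parent-y : parent′ y ≡ y
  parent-y = ≔-same _ y
  parent-ρ : parent′ ρ ≡ y
  parent-ρ = trans (≔-other _ py≢y) (≔-same _ ρ)

  rank′≤ : ∀ z → rank′ z ≤ suc (rank F z)
  rank′≤ z with z ≟ᶠ y
  ... | yes _ = z≤n
  ... | no  _ = ≤-refl

  descends′ : ∀ v → parent′ v ≢ v → rank′ (parent′ v) < rank′ v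
  descends′ v p′v≢v with v ≟ᶠ y
  ... | yes refl = contradiction refl p′v≢v
  ... | no v≢y with v ≟ᶠ ρ
  ...   | yes refl rewrite ≔-same {A = ℕ} (suc ∘ rank F) y {0} = z<s
  ...   | no v≢ρ = s≤s (≤-trans (rank′≤ (parent F v)) (descends F v p′v≢v))

  F′ : Forest (Fin n)
  F′ = record { parent = parent′ ; rank = rank′ ; descends = descends′ }

  F≼F′ : F ≼ F′
  F≼F′ v pv≢v with v ≟ᶠ y
  ... | yes refl = inj₂ parent-ρ
  ... | no v≢y with v ≟ᶠ ρ
  ...   | yes refl = contradiction ppy≡py pv≢v
  ...   | no v≢ρ = inj₁ refl

  F′≼F : F′ ≼ F
  F′≼F v p′v≢v with v ≟ᶠ y
  ... | yes refl = contradiction refl p′v≢v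
  ... | no v≢y with v ≟ᶠ ρ
  ...   | yes refl = inj₂ refl
  ...   | no v≢ρ = inj₁ refl

-- First the parent of `y` is made a root. The edge between the two survives and must point from `y`
-- to that root, so one `swapRoot` finishes.
reroot : ∀ (F : Forest (Fin n)) k y → rank F y ≤ k →
         ∃ λ F′ → F ≼ F′ × F′ ≼ F × parent F′ y ≡ y
reroot F k y r≤k with parent F y ≟ᶠ y
reroot F k       y r≤k | yes py≡y = F , ≼-refl F , ≼-refl F , py≡y
reroot F zero    y r≤k | no py≢y  = contradiction (<-≤-trans (descends F y py≢y) r≤k) n≮0
reroot F (suc k) y r≤k | no py≢y
  with F₁ , F≼F₁ , F₁≼F , isRoot ←
         reroot F k (parent F y) (s≤s⁻¹ (<-≤-trans (descends F y py≢y) r≤k))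
  with F≼F₁ y py≢y
... | inj₂ p₁py≡y = contradiction (trans (sym isRoot) p₁py≡y) py≢y
... | inj₁ p₁y≡py
  with F₂ , F₁≼F₂ , F₂≼F₁ , isRoot′ ←
         swapRoot F₁ y (trans (cong (parent F₁) p₁y≡py) (trans isRoot (sym p₁y≡py)))
           (py≢y ∘ trans (sym p₁y≡py)) =
  F₂ , ≼-trans F F₁ F₂ F≼F₁ F₁≼F₂ , ≼-trans F₂ F₁ F F₂≼F₁ F₁≼F , isRoot′

hang : (F : Forest (Fin n)) (y x : Fin n) → parent F y ≡ y → root F x ≢ y → Forest (Fin n)
hang {n} F y x py≡y rx≢y = record { parent = parent′ ; rank = rank′ ; descends = descends′ }
  where
  parent′ : Fin n → Fin n
  parent′ = parent F [ y ≔ x ]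

  -- The whole tree of `y` is lifted until `y` lies above `x`. Since `x` belongs to another tree,
  -- its own rank does not move.
  rank′ : Fin n → ℕ
  rank′ v with root F v ≟ᶠ y
  ... | yes _ = rank F v + suc (rank F x)
  ... | no  _ = rank F v

  rank′-x : rank′ x ≡ rank F x
  rank′-x with root F x ≟ᶠ y
  ... | yes rx≡y = contradiction rx≡y rx≢y
  ... | no _     = refl

  rank′-y : rank′ y ≡ rank F y + suc (rank F x)
  rank′-y with root F y ≟ᶠ y
  ... | yes _   = refl
  ... | no ry≢y = contradiction (isRoot⇒root F py≡y) ry≢y

  rank′-mono : ∀ u v → root F u ≡ root F v → rank F u < rank F v → rank′ u < rank′ v
  rank′-mono u v eq u<v with root F u ≟ᶠ y | root F v ≟ᶠ y
  ... | yes _ | yes _ = +-mono-<-≤ u<v ≤-refl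
  ... | no _  | no _  = u<v
  ... | yes p | no q  = contradiction (trans (sym eq) p) q
  ... | no q  | yes p = contradiction (trans eq p) q

  descends′ : ∀ v → parent′ v ≢ v → rank′ (parent′ v) < rank′ v
  descends′ v p′v≢v with v ≟ᶠ y
  ... | yes refl rewrite rank′-x | rank′-y = m≤n+m _ (rank F y)
  ... | no _ = rank′-mono (parent F v) v (root-parent F v) (descends F v p′v≢v)

-- Two different components are joined by an edge after rerooting one of them.
merge : ∀ (F : Forest (Fin n)) x y → root F x ≢ root F y → ∀ {R} → Symmetric R →
        ParentEdgesIn R F → R y x → ∃ λ F′ → F ≼ F′ × Link F′ x y × ParentEdgesIn R F′
merge {n} F x y rx≢ry {R} symR s Ryx
  with F₁ , F≼F₁ , F₁≼F , isRoot ← reroot F (rank F y) y ≤-refl =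
  F′ , ≼-trans F F₁ F′ F≼F₁ F₁≼F′ , inj₂ (≔-same _ y) , s′
  where
  r₁x≢y : root F₁ x ≢ y
  r₁x≢y eq = rx≢ry (root-mono F₁ F F₁≼F (trans eq (sym (isRoot⇒root F₁ isRoot))))

  F′ : Forest (Fin n)
  F′ = hang F₁ y x isRoot r₁x≢y

  F₁≼F′ : F₁ ≼ F′
  F₁≼F′ v pv≢v with v ≟ᶠ y
  ... | yes refl = contradiction isRoot pv≢v
  ... | no _     = inj₁ refl

  s′ : ParentEdgesIn R F′
  s′ v p′v≢v with v ≟ᶠ y
  ... | yes refl = Ryx
  ... | no _     = ≼-parentEdgesIn F F₁ symR F₁≼F s v p′v≢v

-- Greedy as in Kruskal's algorithm: an edge of `G` between two components triggers a merge, and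
-- `root-mono` preserves what was achieved for the edges treated before.
saturate : ∀ (G : Graph n) (F : Forest (Fin n)) → ParentEdgesIn (Adj G) F →
           (es : List (Fin n × Fin n)) →
           ∃ λ F′ → F ≼ F′ × ParentEdgesIn (Adj G) F′ ×
             (∀ {x y} → (x , y) ∈ˡ es → Adj G x y → root F′ x ≡ root F′ y)
saturate G F s [] = F , ≼-refl F , s , λ ()
saturate G F s ((x , y) ∷ es) with saturate G F s es
... | F₁ , F≼F₁ , s₁ , sat with root F₁ x ≟ᶠ root F₁ y
...   | yes eq = F₁ , F≼F₁ , s₁ , λ { (here refl) _ → eq ; (there xy∈) → sat xy∈ }
...   | no neq with adj? G x y
...     | no ¬xy = F₁ , F≼F₁ , s₁ ,
                   λ { (here refl) xy → contradiction xy ¬xy ; (there xy∈) → sat xy∈ }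
...     | yes xy with merge F₁ x y neq (adjSym G) s₁ (adjSym G xy)
...       | F₂ , F₁≼F₂ , link , s₂ = F₂ , ≼-trans F F₁ F₂ F≼F₁ F₁≼F₂ , s₂ ,
              λ { (here refl) _  → root-link F₂ link
                ; (there xy∈) xy → root-mono F₁ F₂ F₁≼F₂ (sat xy∈ xy) }

spanningTree : ∀ (G : Graph n) → Connected G → (F : Forest (Fin n)) → ParentEdgesIn (Adj G) F →
               ∃ λ F′ → F ≼ F′ × ParentEdgesIn (Adj G) F′ × (∀ x y → root F′ x ≡ root F′ y)
spanningTree {n} G conn F s
  with F′ , F≼F′ , s′ , sat ← saturate G F s (cartesianProduct (allFin n) (allFin n)) =
  F′ , F≼F′ , s′ , λ x y → walk (conn x y)
  where
  walk : ∀ {x y} → Star (Adj G) x y → root F′ x ≡ root F′ y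
  walk ε       = refl
  walk (e ◅ w) = trans (sat (∈-cartesianProduct⁺ (∈-allFin _) (∈-allFin _)) e) (walk w)

-- Trees and strong collapses

∃-maximising : {P : Pred (Fin n) 0ℓ} (P? : Decidable P) (f : Fin n → ℕ) → ∃ P →
               ∃ λ x → P x × (∀ y → P y → f y ≤ f x)
∃-maximising {n} P? f (x₀ , p₀) =
    argmax f x₀ xs
  , argmax-all f p₀ (all-filter P? (allFin n))
  , λ y py → All.lookup (f[xs]≤f[argmax] x₀ xs) (∈-filter⁺ P? (∈-allFin y) py)
  where xs = filter P? (allFin n)

x∉p-x : (p : Subset n) (x : Fin n) → x ∉ p - x
x∉p-x (inside  ∷ p) (Fin.suc x) (there x∈) = x∉p-x p x x∈
x∉p-x (outside ∷ p) (Fin.suc x) (there x∈) = x∉p-x p x x∈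

⁅⁆⊆ : ∀ {x : Fin n} {p} → x ∈ p → ⁅ x ⁆ ⊆ p
⁅⁆⊆ {x = x} {p} x∈p y∈ = subst (_∈ p) (sym (x∈⁅y⁆⇒x≡y x y∈)) x∈p

x∈pairˡ : (x y : Fin n) → x ∈ ⁅ x ⁆ ∪ ⁅ y ⁆
x∈pairˡ x y = x∈p∪q⁺ (inj₁ (x∈⁅x⁆ x))

y∈pairʳ : (x y : Fin n) → y ∈ ⁅ x ⁆ ∪ ⁅ y ⁆
y∈pairʳ x y = x∈p∪q⁺ {p = ⁅ x ⁆} (inj₂ (x∈⁅x⁆ y))

∈-pair⁻ : {x y z : Fin n} → z ∈ ⁅ x ⁆ ∪ ⁅ y ⁆ → z ≡ x ⊎ z ≡ y
∈-pair⁻ {x = x} {y} = Sum.map (x∈⁅y⁆⇒x≡y x) (x∈⁅y⁆⇒x≡y y) ∘ x∈p∪q⁻ ⁅ x ⁆ ⁅ y ⁆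

pair⊆ : ∀ {x y : Fin n} {p} → x ∈ p → y ∈ p → ⁅ x ⁆ ∪ ⁅ y ⁆ ⊆ p
pair⊆ {p = p} x∈p y∈p z∈ with ∈-pair⁻ z∈
... | inj₁ refl = x∈p
... | inj₂ refl = y∈p

graphSimplex-pair : (G : Graph n) {u v : Fin n} → u ≢ v → GraphSimplex G (⁅ u ⁆ ∪ ⁅ v ⁆) → Adj G u v
graphSimplex-pair G {u} {v} u≢v (inj₁ (x , eq)) = contradiction
  (trans (x∈⁅y⁆⇒x≡y x (subst (u ∈_) eq (x∈pairˡ u v)))
         (sym (x∈⁅y⁆⇒x≡y x (subst (v ∈_) eq (y∈pairʳ u v))))) u≢v
graphSimplex-pair G {u} {v} u≢v (inj₂ (x , y , xy , eq))
  with ∈-pair⁻ (subst (u ∈_) eq (x∈pairˡ u v)) | ∈-pair⁻ (subst (v ∈_) eq (y∈pairʳ u v))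
... | inj₁ refl | inj₁ refl = contradiction refl u≢v
... | inj₁ refl | inj₂ refl = xy
... | inj₂ refl | inj₁ refl = adjSym G xy
... | inj₂ refl | inj₂ refl = contradiction refl u≢v

forestGraph : Forest (Fin n) → Graph n
forestGraph F = record
  { Adj    = λ u v → u ≢ v × Link F u v
  ; adj?   = λ u v → ¬? (u ≟ᶠ v) ×-dec (parent F u ≟ᶠ v ⊎-dec parent F v ≟ᶠ u)
  ; adjSym = λ (u≢v , l) → u≢v ∘ sym , Sum.swap l
  ; irrefl = λ eq (u≢v , _) → u≢v eq
  }

-- Repeatedly removes a vertex of maximal rank, which is a leaf dominated by its parent.
restrictedTree-collapsible :
  (F : Forest (Fin n)) (ρ : Fin n) → parent F ρ ≡ ρ → (∀ v → parent F v ≡ v → v ≡ ρ) →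
  (S : Subset n) → Acc _<_ ∣ S ∣ → ρ ∈ S → (∀ {v} → v ∈ S → parent F v ∈ S) →
  (K : Complex n) →
  (∀ {σ} → Simplex K σ → GraphSimplex (forestGraph F) σ × σ ⊆ S) →
  (∀ {σ} → GraphSimplex (forestGraph F) σ → σ ⊆ S → Simplex K σ) →
  StronglyCollapsible K
restrictedTree-collapsible {n} F ρ pρ≡ρ unique S (acc rs) ρ∈S closed K K⇒ ⇒K
  with any? (λ v → (v ∈? S) ×-dec ¬? (v ≟ᶠ ρ))
... | no none = K , ε , ρ , ⇒K (inj₁ (ρ , refl)) (⁅⁆⊆ ρ∈S)
              , λ σ s → singleton (nonempty K s) (proj₂ (K⇒ s))
  where
  ≡ρ : ∀ {v} → v ∈ S → v ≡ ρ
  ≡ρ {v} v∈S = decidable-stable (v ≟ᶠ ρ) λ v≢ρ → none (v , v∈S , v≢ρ)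

  singleton : ∀ {σ} → Nonempty σ → σ ⊆ S → σ ≡ ⁅ ρ ⁆
  singleton (v , v∈σ) σ⊆S with refl ← ≡ρ (σ⊆S v∈σ) =
    ⊆-antisym (λ w∈σ → subst (_∈ ⁅ ρ ⁆) (sym (≡ρ (σ⊆S w∈σ))) (x∈⁅x⁆ ρ)) (⁅⁆⊆ v∈σ)
... | yes some
  with z , (z∈S , z≢ρ) , max ← ∃-maximising (λ v → (v ∈? S) ×-dec ¬? (v ≟ᶠ ρ)) (rank F) some
  = let (L , ↘L , p) = restrictedTree-collapsible F ρ pρ≡ρ unique (S - z) (rs (x∈p⇒∣p-x∣<∣p∣ z∈S))
                         (x∈p∧x≢y⇒x∈p-y ρ∈S (z≢ρ ∘ sym)) closed′ (delete K z)
                         (λ {σ} (s , z∉σ) → proj₁ (K⇒ s) , λ {x} x∈σ →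
                            x∈p∧x≢y⇒x∈p-y (proj₂ (K⇒ s) x∈σ) λ x≡z → z∉σ (subst (_∈ σ) x≡z x∈σ))
                         (λ g σ⊆ → ⇒K g (λ x∈ → p─q⊆p S ⁅ z ⁆ (σ⊆ x∈)) , λ z∈σ → x∉p-x S z (σ⊆ z∈σ))
    in L , collapse dominated ◅ ↘L , p
  where
  u = parent F z

  u≢z : u ≢ z
  u≢z pz≡z = z≢ρ (unique z pz≡z)

  -- A child of `z` has larger rank than `z`, against maximality. It cannot be `ρ` either, because
  -- `ρ` is its own parent and `z ≢ ρ`.
  leaf : ∀ {w} → w ∈ S → w ≢ z → parent F w ≢ z
  leaf {w} w∈S w≢z refl = <⇒≱ (descends F w (w≢z ∘ sym)) (max w (w∈S , λ w≡ρ →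
    w≢z (trans w≡ρ (trans (sym pρ≡ρ) (cong (parent F) (sym w≡ρ))))))

  closed′ : ∀ {v} → v ∈ S - z → parent F v ∈ S - z
  closed′ {v} v∈ = x∈p∧x≢y⇒x∈p-y (closed v∈S) (leaf v∈S λ { refl → x∉p-x S v v∈ })
    where v∈S = p─q⊆p S ⁅ z ⁆ v∈

  dominates : ∀ σ → Maximal K σ → z ∈ σ → u ∈ σ
  dominates σ (s , maximal) z∈σ with K⇒ s
  ... | inj₁ (x , refl) , _ with refl ← x∈⁅y⁆⇒x≡y x z∈σ =
        subst (u ∈_)
          (maximal (⁅ z ⁆ ∪ ⁅ u ⁆)
            (⇒K (inj₂ (z , u , (u≢z ∘ sym , inj₁ refl) , refl)) (pair⊆ z∈S (closed z∈S)))
            (⁅⁆⊆ (x∈pairˡ z u)))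
          (y∈pairʳ z u)
  ... | inj₂ (x , y , (x≢y , link) , refl) , σ⊆S with ∈-pair⁻ z∈σ | link
  ...   | inj₁ refl | inj₁ refl = y∈pairʳ x y
  ...   | inj₁ refl | inj₂ py≡z = contradiction py≡z (leaf (σ⊆S (y∈pairʳ x y)) (x≢y ∘ sym))
  ...   | inj₂ refl | inj₁ px≡z = contradiction px≡z (leaf (σ⊆S (x∈pairˡ x y)) x≢y)
  ...   | inj₂ refl | inj₂ refl = x∈pairˡ x y

  dominated : Dominated K z u
  dominated = record
    { distinct  = u≢z
    ; v-vertex  = ⇒K (inj₁ (z , refl)) (⁅⁆⊆ z∈S)
    ; u-vertex  = ⇒K (inj₁ (u , refl)) (⁅⁆⊆ (closed z∈S))
    ; dominates = dominates
    }

tree-collapsible : (F : Forest (Fin n)) → Fin n → (∀ x y → root F x ≡ root F y) →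
                   StronglyCollapsible (toComplex (forestGraph F))
tree-collapsible F x₀ connected =
  restrictedTree-collapsible F (root F x₀) (root-isRoot F x₀)
    (λ v pv≡v → trans (sym (isRoot⇒root F pv≡v)) (connected v x₀))
    full (<-wellFounded _) ∈⊤ (λ _ → ∈⊤) (toComplex (forestGraph F))
    (λ g → g , λ _ → ∈⊤) (λ g _ → g)

-- No simplex of a graph has three vertices.
pair-maximal : (G : Graph n) (K : Complex n) → K ⊑ toComplex G → ∀ {u v} → u ≢ v →
               Simplex K (⁅ u ⁆ ∪ ⁅ v ⁆) → Maximal K (⁅ u ⁆ ∪ ⁅ v ⁆)
pair-maximal G K K⊑G {u} {v} u≢v s = s , λ τ t σ⊆τ →
  ⊆-antisym (τ⊆ (K⊑G t) (σ⊆τ (x∈pairˡ u v)) (σ⊆τ (y∈pairʳ u v))) σ⊆τ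
  where
  τ⊆ : ∀ {τ} → GraphSimplex G τ → u ∈ τ → v ∈ τ → τ ⊆ ⁅ u ⁆ ∪ ⁅ v ⁆
  τ⊆ (inj₁ (x , refl)) u∈ v∈ =
    contradiction (trans (x∈⁅y⁆⇒x≡y x u∈) (sym (x∈⁅y⁆⇒x≡y x v∈))) u≢v
  τ⊆ (inj₂ (x , y , _ , refl)) u∈ v∈ with ∈-pair⁻ u∈ | ∈-pair⁻ v∈
  ... | inj₁ refl | inj₁ refl = contradiction refl u≢v
  ... | inj₁ refl | inj₂ refl = id
  ... | inj₂ refl | inj₁ refl = pair⊆ (y∈pairʳ u v) (x∈pairˡ u v)
  ... | inj₂ refl | inj₂ refl = contradiction refl u≢v

module _ (G : Graph n) (K : Complex n) (K⊑G : K ⊑ toComplex G) {v u} (d : Dominated K v u) where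
  open Dominated d

  -- An edge at `v` is a maximal simplex and hence contains `u`: in dimension one, a dominated
  -- vertex has no neighbour but the dominating one.
  dominated-neighbour : ∀ {w} → v ≢ w → Simplex K (⁅ v ⁆ ∪ ⁅ w ⁆) → w ≡ u
  dominated-neighbour {w} v≢w s
    with ∈-pair⁻ (dominates _ (pair-maximal G K K⊑G v≢w s) (x∈pairˡ v w))
  ... | inj₁ u≡v = contradiction u≡v distinct
  ... | inj₂ u≡w = sym u≡w

  -- Without this edge `v` would be isolated, and the maximal simplex `⁅ v ⁆` would have to contain
  -- `u`.
  dominated-edge : Simplex K (⁅ v ⁆ ∪ ⁅ u ⁆)
  dominated-edge = decidable-stable (simplex? K _) λ ¬s →
    distinct (x∈⁅y⁆⇒x≡y v (dominates ⁅ v ⁆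
      (v-vertex , λ τ t v⊆τ → maximal ¬s t (K⊑G t) (v⊆τ (x∈⁅x⁆ v))) (x∈⁅x⁆ v)))
    where
    maximal : ¬ Simplex K (⁅ v ⁆ ∪ ⁅ u ⁆) → ∀ {τ} → Simplex K τ → GraphSimplex G τ → v ∈ τ → τ ≡ ⁅ v ⁆
    maximal ¬s t (inj₁ (x , refl)) v∈ = cong ⁅_⁆ (sym (x∈⁅y⁆⇒x≡y x v∈))
    maximal ¬s t (inj₂ (x , y , xy , refl)) v∈ with ∈-pair⁻ v∈
    ... | inj₁ refl with refl ← dominated-neighbour (λ eq → irrefl G eq xy) t = contradiction t ¬s
    ... | inj₂ refl with t′ ← subst (Simplex K) (∪-comm ⁅ x ⁆ ⁅ v ⁆) t
                    with refl ← dominated-neighbour (λ eq → irrefl G (sym eq) xy) t′ =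
                      contradiction t′ ¬s

SpansEdges : Complex n → Forest (Fin n) → Set
SpansEdges K F = ParentEdgesIn (λ u v → Simplex K (⁅ u ⁆ ∪ ⁅ v ⁆)) F
               × (∀ {u v} → u ≢ v → Simplex K (⁅ u ⁆ ∪ ⁅ v ⁆) → Link F u v)

-- Reading a strong collapse backwards hangs each removed vertex below its dominating one.
collapse⇒forest : (G : Graph n) {K L : Complex n} → K ⊑ toComplex G → K ↘↘ L → IsVertex L →
                  ∃ (SpansEdges K)
collapse⇒forest {n} G {K} K⊑G ε (w , _ , single) =
    record { parent = id ; rank = λ _ → 0 ; descends = λ v v≢v → contradiction refl v≢v }
  , (λ v v≢v → contradiction refl v≢v)
  , λ {u} {v} u≢v s → contradiction
      (trans (x∈⁅y⁆⇒x≡y w (subst (u ∈_) (single _ s) (x∈pairˡ u v)))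
             (sym (x∈⁅y⁆⇒x≡y w (subst (v ∈_) (single _ s) (y∈pairʳ u v))))) u≢v
collapse⇒forest {n} G {K} K⊑G (collapse {v = v} {u} d ◅ ↘L) isV
  with F , s , c ← collapse⇒forest G {delete K v} (λ t → K⊑G (proj₁ t)) ↘L isV =
  F′ , s′ , c′
  where
  open Dominated d using (distinct)

  -- No edge of `delete K v` meets `v`, so `v` is isolated in `F`: it is a root and has no children.
  isRoot : parent F v ≡ v
  isRoot = decidable-stable (parent F v ≟ᶠ v) λ pv≢v → proj₂ (s v pv≢v) (x∈pairˡ v _)

  childless : ∀ w → w ≢ v → parent F w ≢ v
  childless w w≢v refl = proj₂ (s w (w≢v ∘ sym)) (y∈pairʳ w _)

  climb≢v : ∀ k w → w ≢ v → climb F k w ≢ v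
  climb≢v zero    w w≢v = w≢v
  climb≢v (suc k) w w≢v = climb≢v k (parent F w) (childless w w≢v)

  F′ : Forest (Fin n)
  F′ = hang F v u isRoot (climb≢v (rank F u) u distinct)

  s′ : ParentEdgesIn (λ x y → Simplex K (⁅ x ⁆ ∪ ⁅ y ⁆)) F′
  s′ x p′x≢x with x ≟ᶠ v
  ... | yes refl = dominated-edge G K K⊑G d
  ... | no _     = proj₁ (s x p′x≢x)

  c′ : ∀ {x y} → x ≢ y → Simplex K (⁅ x ⁆ ∪ ⁅ y ⁆) → Link F′ x y
  c′ {x} {y} x≢y t with x ≟ᶠ v | y ≟ᶠ v
  ... | yes refl | _ = inj₁ (sym (dominated-neighbour G K K⊑G d x≢y t))
  ... | no _ | yes refl = inj₂ (sym (dominated-neighbour G K K⊑G d (x≢y ∘ sym)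
                                      (subst (Simplex K) (∪-comm ⁅ x ⁆ ⁅ y ⁆) t)))
  ... | no x≢v | no y≢v = c x≢y (t , λ v∈ → case ∈-pair⁻ v∈ of λ
                            { (inj₁ v≡x) → x≢v (sym v≡x) ; (inj₂ v≡y) → y≢v (sym v≡y) })

-- Strongly collapsible covers and forest covers

record ForestCover {V : Set} (R : Rel V 0ℓ) (k : ℕ) : Set where
  field
    forest : Fin k → Forest V
    within : ∀ i → ParentEdgesIn R (forest i)
    spans  : ∀ {u v} → R u v → ∃ λ i → Link (forest i) u v

open ForestCover

cover⇒forestCover : (G : Graph n) {m : ℕ} → Cover (toComplex G) m → ForestCover (Adj G) (suc m)
cover⇒forestCover G c = record
  { forest = λ i → proj₁ (F i)
  ; within = λ i v pv≢v →
      graphSimplex-pair G (pv≢v ∘ sym) (subcomplex i (proj₁ (proj₂ (F i)) v pv≢v))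
  ; spans  = λ {u} {v} uv →
      let (i , s) = covers _ (inj₂ (u , v , uv , refl))
      in i , proj₂ (proj₂ (F i)) (λ eq → irrefl G eq uv) s
  }
  where
  open Cover c
  F : ∀ i → ∃ (SpansEdges (piece i))
  F i = let (_ , ↘L , isV) = collapsible i in collapse⇒forest G (subcomplex i) ↘L isV

-- A forest may be disconnected and then is not strongly collapsible; extending it to a spanning
-- tree keeps its edges and repairs this.
forestCover⇒cover : (G : Graph n) → Connected G → Fin n → {m : ℕ} →
                    ForestCover (Adj G) (suc m) → Cover (toComplex G) m
forestCover⇒cover {n} G conn x₀ {m} c = record
  { piece       = λ i → toComplex (forestGraph (proj₁ (T i)))
  ; subcomplex  = sub
  ; collapsible = λ i → tree-collapsible (proj₁ (T i)) x₀ (proj₂ (proj₂ (proj₂ (T i))))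
  ; covers      = cov
  }
  where
  T : ∀ i → ∃ λ F′ → forest c i ≼ F′ × ParentEdgesIn (Adj G) F′ × (∀ x y → root F′ x ≡ root F′ y)
  T i = spanningTree G conn (forest c i) (within c i)

  sub : ∀ i {σ} → GraphSimplex (forestGraph (proj₁ (T i))) σ → GraphSimplex G σ
  sub i (inj₁ s) = inj₁ s
  sub i (inj₂ (u , v , (u≢v , link) , eq)) =
    let (F′ , _ , s , _) = T i
    in inj₂ (u , v , parentEdgesIn-link F′ (adjSym G) s u≢v link , eq)

  cov : ∀ σ → GraphSimplex G σ → ∃ λ i → GraphSimplex (forestGraph (proj₁ (T i))) σ
  -- Every piece is spanning, so piece 0 already contains all single vertices; only edges need the
  -- forest cover.
  cov σ (inj₁ s) = Fin.zero , inj₁ s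
  cov σ (inj₂ (u , v , uv , eq)) =
    let (i , link)         = spans c uv
        (F′ , F≼F′ , _ , _) = T i
        link′              = parentEdgesIn-link (forest c i) (link-sym F′) F≼F′ u≢v link
    in i , inj₂ (u , v , (u≢v , link′) , eq)
    where
    u≢v : u ≢ v
    u≢v eq′ = irrefl G eq′ uv

-- Edge covers by forests

module _ (G : Graph n) (v₀ : Fin n) where

  gscat-forestCover : ForestCover (Adj G) (suc (gscat (toComplex G)))
  gscat-forestCover =
    cover⇒forestCover G (proj₁ (gscat-isGscat (toComplex G) (_ , inj₁ (v₀ , refl))))

  gscat-minimal : Connected G → ∀ {m} → ForestCover (Adj G) (suc m) → gscat (toComplex G) ≤ m
  gscat-minimal conn c =
    proj₂ (gscat-isGscat (toComplex G) (_ , inj₁ (v₀ , refl))) _ (forestCover⇒cover G conn v₀ c)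

module _ {m : ℕ} (f : Fin n → Fin m) (f-injective : ∀ {x y} → f x ≡ f y → x ≡ y) where

  -- A vertex whose parent leaves the image of `f` becomes a root. The remaining edges keep their
  -- ranks, so no cycle appears.
  restrict : Forest (Fin m) → Forest (Fin n)
  restrict F = record { parent = parent′ ; rank = rank F ∘ f ; descends = descends′ }
    where
    parent′ : Fin n → Fin n
    parent′ v with any? (λ w → f w ≟ᶠ parent F (f v))
    ... | yes (w , _) = w
    ... | no _        = v

    descends′ : ∀ v → parent′ v ≢ v → rank F (f (parent′ v)) < rank F (f v)
    descends′ v p′v≢v with any? (λ w → f w ≟ᶠ parent F (f v))
    ... | yes (w , eq) rewrite eq =
          descends F (f v) λ pfv≡fv → p′v≢v (f-injective (trans eq pfv≡fv))
    ... | no _ = contradiction refl p′v≢v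

  restrict-parent : ∀ F {u v} → parent F (f u) ≡ f v → parent (restrict F) u ≡ v
  restrict-parent F {u} {v} eq with any? (λ w → f w ≟ᶠ parent F (f u))
  ... | yes (w , eq′) = f-injective (trans eq′ eq)
  ... | no none       = contradiction (v , sym eq) none

  restrict-within : ∀ F {R} → ParentEdgesIn R F → ParentEdgesIn (R on f) (restrict F)
  restrict-within F {R} s v p′v≢v with any? (λ w → f w ≟ᶠ parent F (f v))
  ... | yes (w , eq) = subst (R (f v)) (sym eq)
          (s (f v) λ pfv≡fv → p′v≢v (f-injective (trans eq pfv≡fv)))
  ... | no _ = contradiction refl p′v≢v

  restrictCover : ∀ {R k} → ForestCover R k → ForestCover (R on f) k
  restrictCover {R} c = record
    { forest = restrict ∘ forest c
    ; within = λ i → restrict-within (forest c i) {R} (within c i)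
    ; spans  = λ uv → let (i , link) = spans c uv in
        i , Sum.map (restrict-parent (forest c i)) (restrict-parent (forest c i)) link
    }

mapCover : ∀ {V} {R R′ : Rel V 0ℓ} {k} → (∀ {u v} → R u v → R′ u v) → (∀ {u v} → R′ u v → R u v) →
           ForestCover R k → ForestCover R′ k
mapCover to from c = record
  { forest = forest c
  ; within = λ i v pv≢v → to (within c i v pv≢v)
  ; spans  = spans c ∘ from
  }

module _ {V W : Set} (f : W → V) (g : V → W) (fg : ∀ v → f (g v) ≡ v) (gf : ∀ w → g (f w) ≡ w) where

  transport : Forest V → Forest W
  transport F = record
    { parent   = g ∘ parent F ∘ f
    ; rank     = rank F ∘ f
    ; descends = λ w gpfw≢w → subst (λ v → rank F v < rank F (f w)) (sym (fg _))
        (descends F (f w) λ pfw≡fw → gpfw≢w (trans (cong g pfw≡fw) (gf w)))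
    }

  transportCover : ∀ {R k} → ForestCover R k → ForestCover (R on f) k
  transportCover {R} c = record
    { forest = transport ∘ forest c
    ; within = λ i w gpfw≢w → subst (R (f w)) (sym (fg _))
        (within c i (f w) λ pfw≡fw → gpfw≢w (trans (cong g pfw≡fw) (gf w)))
    ; spans  = λ uv → let (i , link) = spans c uv in
        i , Sum.map (λ eq → trans (cong g eq) (gf _)) (λ eq → trans (cong g eq) (gf _)) link
    }

-- Lower bounds: the factors of a join and its cross edges

module _ (G₁ : Graph n₁) (G₂ : Graph n₂) where

  joinCoverˡ : ∀ {k} → ForestCover (Adj (G₁ ✶ G₂)) k → ForestCover (Adj G₁) k
  joinCoverˡ c = mapCover (λ {u} {v} → to {u} {v}) from
                   (restrictCover (_↑ˡ n₂) (↑ˡ-injective n₂ _ _) c)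
    where
    to : ∀ {u v} → Adj (G₁ ✶ G₂) (u ↑ˡ n₂) (v ↑ˡ n₂) → Adj G₁ u v
    to {u} {v} rewrite splitAt-↑ˡ n₁ u n₂ | splitAt-↑ˡ n₁ v n₂ = id
    from : ∀ {u v} → Adj G₁ u v → Adj (G₁ ✶ G₂) (u ↑ˡ n₂) (v ↑ˡ n₂)
    from {u} {v} rewrite splitAt-↑ˡ n₁ u n₂ | splitAt-↑ˡ n₁ v n₂ = id

  joinCoverʳ : ∀ {k} → ForestCover (Adj (G₁ ✶ G₂)) k → ForestCover (Adj G₂) k
  joinCoverʳ c = mapCover (λ {u} {v} → to {u} {v}) from
                   (restrictCover (n₁ ↑ʳ_) (↑ʳ-injective n₁ _ _) c)
    where
    to : ∀ {u v} → Adj (G₁ ✶ G₂) (n₁ ↑ʳ u) (n₁ ↑ʳ v) → Adj G₂ u v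
    to {u} {v} rewrite splitAt-↑ʳ n₁ n₂ u | splitAt-↑ʳ n₁ n₂ v = id
    from : ∀ {u v} → Adj G₂ u v → Adj (G₁ ✶ G₂) (n₁ ↑ʳ u) (n₁ ↑ʳ v)
    from {u} {v} rewrite splitAt-↑ʳ n₁ n₂ u | splitAt-↑ʳ n₁ n₂ v = id

  cross : ∀ u v → Adj (G₁ ✶ G₂) (u ↑ˡ n₂) (n₁ ↑ʳ v)
  cross u v rewrite splitAt-↑ˡ n₁ u n₂ | splitAt-↑ʳ n₁ n₂ v = tt

↑ˡ≢↑ʳ : (u : Fin n₁) (v : Fin n₂) → u ↑ˡ n₂ ≢ n₁ ↑ʳ v
↑ˡ≢↑ʳ {n₁} {n₂} u v eq
  with () ← trans (sym (splitAt-↑ˡ n₁ u n₂)) (trans (cong (splitAt n₁) eq) (splitAt-↑ʳ n₁ n₂ v))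

-- An edge is determined by its forest and its child endpoint, and each forest
-- has at least one vertex that is not a child.
crossEdges-bound : ∀ {N k} {R : Rel (Fin (suc N)) 0ℓ} → ForestCover R k →
                   (f : Fin n₁ → Fin (suc N)) (g : Fin n₂ → Fin (suc N)) →
                   (∀ {x y} → f x ≡ f y → x ≡ y) → (∀ {x y} → g x ≡ g y → x ≡ y) →
                   (∀ u v → f u ≢ g v) → (∀ u v → R (f u) (g v)) → n₁ * n₂ ≤ k * N
crossEdges-bound {n₁} {n₂} {N} {k} c f g f-inj g-inj f≢g edge = injective⇒≤ code-injective
  where
  Child : Fin n₁ → Fin n₂ → Fin k → Fin (suc N) → Set
  Child u v i w = w ≡ f u × parent (forest c i) w ≡ g v ⊎ w ≡ g v × parent (forest c i) w ≡ f u

  child : ∀ u v → ∃₂ (Child u v)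
  child u v with spans c (edge u v)
  ... | i , inj₁ eq = i , f u , inj₁ (refl , eq)
  ... | i , inj₂ eq = i , g v , inj₂ (refl , eq)

  -- The root above vertex 0 is its own parent and is never a child endpoint; `punchOut` removes it
  -- and leaves `N` codes per forest.
  nonRoot : ∀ {u v i w} → Child u v i w → root (forest c i) Fin.zero ≢ w
  nonRoot {u} {v} {i} ch refl with root-isRoot (forest c i) Fin.zero | ch
  ... | fixed | inj₁ (eq , eq′) = f≢g u v (trans (sym eq) (trans (sym fixed) eq′))
  ... | fixed | inj₂ (eq , eq′) = f≢g u v (trans (sym eq′) (trans fixed eq))

  child-unique : ∀ {u v u′ v′ i w} → Child u v i w → Child u′ v′ i w → u ≡ u′ × v ≡ v′
  child-unique (inj₁ (a , b)) (inj₁ (a′ , b′)) =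
    f-inj (trans (sym a) a′) , g-inj (trans (sym b) b′)
  child-unique (inj₂ (a , b)) (inj₂ (a′ , b′)) =
    f-inj (trans (sym b) b′) , g-inj (trans (sym a) a′)
  child-unique (inj₁ (a , b)) (inj₂ (a′ , b′)) = contradiction (trans (sym a) a′) (f≢g _ _)
  child-unique (inj₂ (a , b)) (inj₁ (a′ , b′)) = contradiction (trans (sym a′) a) (f≢g _ _)

  encode : ∀ {u v} → ∃₂ (Child u v) → Fin (k * N)
  encode (i , w , ch) = combine i (punchOut (nonRoot ch))

  encode-injective : ∀ {u v u′ v′} (p : ∃₂ (Child u v)) (q : ∃₂ (Child u′ v′)) →
                     encode p ≡ encode q → u ≡ u′ × v ≡ v′
  encode-injective (i , w , ch) (i′ , w′ , ch′) eq
    with refl , eq′ ← combine-injective i _ i′ _ eq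
    with refl ← punchOut-injective (nonRoot ch) (nonRoot ch′) eq′ = child-unique ch ch′

  code : Fin (n₁ * n₂) → Fin (k * N)
  code e = let (u , v) = remQuot {n₁} n₂ e in encode (child u v)

  code-injective : ∀ {e e′} → code e ≡ code e′ → e ≡ e′
  code-injective {e} {e′} eq =
    let (u , v)   = remQuot {n₁} n₂ e
        (u′ , v′) = remQuot {n₁} n₂ e′
        (p , q)   = encode-injective (child u v) (child u′ v′) eq
    in trans (sym (combine-remQuot {n₁} n₂ e)) (trans (cong₂ combine p q) (combine-remQuot {n₁} n₂ e′))

-- Complete bipartite graphs

module _ (a : ℕ) .{{_ : NonZero a}} where

  -- Sliding the window by one loses only `m`, whose residue comes back at `m + a`.
  residue-exists : ∀ m i → i < a → ∃ λ r → m ≤ r × r < m + a × r % a ≡ i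
  residue-exists zero    i i<a = i , z≤n , i<a , m<n⇒m%n≡m i<a
  residue-exists (suc m) i i<a with residue-exists m i i<a
  ... | r , m≤r , r<m+a , eq with m≤n⇒m<n∨m≡n m≤r
  ...   | inj₁ m<r  = r , m<r , m<n⇒m<1+n r<m+a , eq
  ...   | inj₂ refl = m + a , m<m+n m (>-nonZero⁻¹ a) , n<1+n (m + a) , trans ([m+n]%n≡m%n m a) eq

  -- With equal residues, a larger quotient would put `s` at least `a` above `r`, outside the
  -- window.
  quotient-mono : ∀ {m r s} → m ≤ r → s < m + a → r % a ≡ s % a → s / a ≤ r / a
  quotient-mono {m} {r} {s} m≤r s<m+a eq = ≮⇒≥ λ r/a<s/a → <⇒≱ s<m+a (begin
    m + a                    ≤⟨ +-monoˡ-≤ a m≤r ⟩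
    r + a                    ≡⟨ cong (_+ a) (m≡m%n+[m/n]*n r a) ⟩
    r % a + r / a * a + a    ≡⟨ +-assoc (r % a) _ a ⟩
    r % a + (r / a * a + a)  ≡⟨ cong (r % a +_) (+-comm _ a) ⟩
    r % a + suc (r / a) * a  ≤⟨ +-mono-≤ (≤-reflexive eq) (*-monoˡ-≤ a r/a<s/a) ⟩
    s % a + s / a * a        ≡⟨ m≡m%n+[m/n]*n s a ⟨
    s                        ∎)
    where open ≤-Reasoning

  residue-unique : ∀ {m r s} → m ≤ r → r < m + a → m ≤ s → s < m + a → r % a ≡ s % a → r ≡ s
  residue-unique {m} {r} {s} m≤r r<m+a m≤s s<m+a eq = begin
    r                  ≡⟨ m≡m%n+[m/n]*n r a ⟩
    r % a + r / a * a  ≡⟨ cong₂ (λ x y → x + y * a) eq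
                            (≤-antisym (quotient-mono m≤s r<m+a (sym eq))
                                       (quotient-mono m≤r s<m+a eq)) ⟩
    s % a + s / a * a  ≡⟨ m≡m%n+[m/n]*n s a ⟨
    s                  ∎
    where open ≡-Reasoning

-- Adjacency of the complete bipartite graph with parts `A` and `B`.
Across : ∀ {A B : Set} → Rel (A ⊎ B) 0ℓ
Across (inj₁ _) (inj₂ _) = ⊤
Across (inj₂ _) (inj₁ _) = ⊤
Across _        _        = ⊥

-- The lattice path through the cells (r mod a, j) with P j ≤ r ≤ P (j + 1): it has
-- at most a rows in all, so it visits no row again after leaving it.
module Staircase (a b : ℕ) .{{_ : NonZero a}} (P : ℕ → ℕ)
                 (P-mono : ∀ {i j} → i ≤ j → P i ≤ P j) (short : P b < P 0 + a) where

  -- The representative of row `i` modulo `a` in the window starting at `P 0`; it unrolls the torus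
  -- so that the rows become linearly ordered.
  height : Fin a → ℕ
  height i = proj₁ (residue-exists a (P 0) (toℕ i) (toℕ<n i))

  height-unique : ∀ {i r} → P 0 ≤ r → r < P 0 + a → r % a ≡ toℕ i → height i ≡ r
  height-unique {i} lo hi eq =
    let (_ , lo′ , hi′ , eq′) = residue-exists a (P 0) (toℕ i) (toℕ<n i)
    in residue-unique a lo′ hi′ lo hi (trans eq′ (sym eq))

  -- The strict lower bound selects the first column in which the path meets a row above `P 0`. In
  -- any later column `j` that it meets, the row is `P j` and serves as the parent of the column.
  Enters : Fin a → Fin b → Set
  Enters i j = P (toℕ j) < height i × height i ≤ P (suc (toℕ j))

  enters? : ∀ i → Dec (∃ (Enters i))
  enters? i = any? λ j → (P (toℕ j) <? height i) ×-dec (height i ≤? P (suc (toℕ j)))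

  enters-unique : ∀ {i j j′} → Enters i j → Enters i j′ → j ≡ j′
  enters-unique (lo , hi) (lo′ , hi′) =
    toℕ-injective (≤-antisym (≮⇒≥ (apart lo hi′)) (≮⇒≥ (apart lo′ hi)))
    where
    apart : ∀ {h k k′} → P k < h → h ≤ P (suc k′) → ¬ (k′ < k)
    apart lo hi k′<k = <⇒≱ lo (≤-trans hi (P-mono k′<k))

  parent′ : Fin a ⊎ Fin b → Fin a ⊎ Fin b
  parent′ (inj₁ i) with enters? i
  ... | yes (j , _) = inj₂ j
  ... | no _        = inj₁ i
  parent′ (inj₂ j) = inj₁ (P (toℕ j) mod a)

  -- Doubling the heights makes room for column `j` directly above its parent row `P j` and below
  -- all rows that enter it.
  rank′ : Fin a ⊎ Fin b → ℕ
  rank′ (inj₁ i) = height i + height i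
  rank′ (inj₂ j) = suc (P (toℕ j) + P (toℕ j))

  height-mod : ∀ {j} → j ≤ b → height (P j mod a) ≡ P j
  height-mod j≤b = height-unique (P-mono z≤n) (≤-<-trans (P-mono j≤b) short) (sym (toℕ-fromℕ< _))

  descends′ : ∀ v → parent′ v ≢ v → rank′ (parent′ v) < rank′ v
  descends′ (inj₁ i) p′v≢v with enters? i
  ... | yes (j , lo , _) = +-mono-≤-< lo lo
  ... | no _             = contradiction refl p′v≢v
  descends′ (inj₂ j) _ rewrite height-mod {toℕ j} (<⇒≤ (toℕ<n j)) = n<1+n _

  staircase : Forest (Fin a ⊎ Fin b)
  staircase = record { parent = parent′ ; rank = rank′ ; descends = descends′ }

  staircase-across : ParentEdgesIn Across staircase
  staircase-across (inj₁ i) p′v≢v with enters? i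
  ... | yes _ = tt
  ... | no _  = contradiction refl p′v≢v
  staircase-across (inj₂ j) _ = tt

  staircase-link : ∀ (i : Fin a) (j : Fin b) {r} → r % a ≡ toℕ i →
                   P (toℕ j) ≤ r → r ≤ P (suc (toℕ j)) → Link staircase (inj₁ i) (inj₂ j)
  staircase-link i j {r} eq lo hi with m≤n⇒m<n∨m≡n lo
  ... | inj₂ refl = inj₂ (cong inj₁ (toℕ-injective (trans (toℕ-fromℕ< _) eq)))
  ... | inj₁ lo<  = inj₁ entered
    where
    h≡r : height i ≡ r
    h≡r = height-unique (≤-trans (P-mono z≤n) lo)
            (≤-<-trans (≤-trans hi (P-mono (toℕ<n j))) short) eq

    entersⱼ : Enters i j
    entersⱼ = subst (P (toℕ j) <_) (sym h≡r) lo< , subst (_≤ P (suc (toℕ j))) (sym h≡r) hi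

    entered : parent′ (inj₁ i) ≡ inj₂ j
    entered with enters? i
    ... | yes (j′ , e) = cong inj₂ (enters-unique {i} e entersⱼ)
    ... | no none      = contradiction (j , entersⱼ) none

-- A discrete intermediate value argument, searching downwards from `c`.
stepAt : ∀ (Q : ℕ → ℕ) {r} c → Q 0 ≤ r → r < Q c → ∃ λ k → k < c × Q k ≤ r × r < Q (suc k)
stepAt Q zero    lo hi = contradiction hi (≤⇒≯ lo)
stepAt Q {r} (suc c) lo hi with r <? Q c
... | no r≮  = c , n<1+n c , ≮⇒≥ r≮ , hi
... | yes r< with k , k<c , lo′ , hi′ ← stepAt Q c lo r< = k , m<n⇒m<1+n k<c , lo′ , hi′

-- Forest k contains in column j the rows from f (j + k) + k to f (j + k + 1) + k
-- modulo a.  For fixed j these intervals tile a full period, since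
-- f (j + c) + c = f j + a.
module _ (a′ e c b : ℕ) .{{_ : NonZero c}} (a≡e+c : suc a′ ≡ e + c) (few : b * e ≤ a′ * c) where

  private
    -- A digitised line of slope `e / c`, where `e` is the number of rows minus `c`. Over `c` steps
    -- it rises by exactly `e`, and the summand `k` in `P k` supplies the missing `c` of a full
    -- period.
    f : ℕ → ℕ
    f t = t * e / c

    f-mono : ∀ {s t} → s ≤ t → f s ≤ f t
    f-mono s≤t = /-monoˡ-≤ c (*-monoˡ-≤ e s≤t)

    f-period : ∀ t → f (t + c) ≡ f t + e
    f-period t = begin
      (t + c) * e / c      ≡⟨ cong (_/ c) (trans (*-distribʳ-+ e t c) (cong (t * e +_) (*-comm c e))) ⟩
      (t * e + e * c) / c  ≡⟨ +-distrib-/-∣ʳ (t * e) (n∣m*n e) ⟩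
      f t + e * c / c      ≡⟨ cong (f t +_) (m*n/n≡m e c) ⟩
      f t + e              ∎
      where open ≡-Reasoning

    -- The edge count enters here: `b * e ≤ a′ * c` bounds the rise over all `b` columns by `a′`,
    -- one less than the number of rows.
    f-short : ∀ k → f (b + k) ≤ f k + a′
    f-short k = begin
      (b + k) * e / c       ≡⟨ cong (_/ c) (trans (*-distribʳ-+ e b k) (+-comm (b * e) (k * e))) ⟩
      (k * e + b * e) / c   ≤⟨ /-monoˡ-≤ c (+-monoʳ-≤ (k * e) few) ⟩
      (k * e + a′ * c) / c  ≡⟨ +-distrib-/-∣ʳ (k * e) (n∣m*n a′) ⟩
      f k + a′ * c / c      ≡⟨ cong (f k +_) (m*n/n≡m a′ c) ⟩
      f k + a′              ∎
      where open ≤-Reasoning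

    P : ℕ → ℕ → ℕ
    P k j = f (j + k) + k

    P-mono : ∀ k {i j} → i ≤ j → P k i ≤ P k j
    P-mono k i≤j = +-monoˡ-≤ k (f-mono (+-monoˡ-≤ k i≤j))

    P-short : ∀ k → P k b < P k 0 + suc a′
    P-short k = begin-strict
      f (b + k) + k     ≤⟨ +-monoˡ-≤ k (f-short k) ⟩
      f k + a′ + k      ≡⟨ +-assoc (f k) a′ k ⟩
      f k + (a′ + k)    ≡⟨ cong (f k +_) (+-comm a′ k) ⟩
      f k + (k + a′)    ≡⟨ +-assoc (f k) k a′ ⟨
      f k + k + a′      <⟨ +-monoʳ-< (f k + k) (n<1+n a′) ⟩
      f k + k + suc a′  ∎
      where open ≤-Reasoning

    P-period : ∀ j → P c j ≡ P 0 j + suc a′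
    P-period j = begin
      f (j + c) + c           ≡⟨ cong (_+ c) (f-period j) ⟩
      f j + e + c             ≡⟨ +-assoc (f j) e c ⟩
      f j + (e + c)           ≡⟨ cong (f j +_) a≡e+c ⟨
      f j + suc a′            ≡⟨ cong (λ i → f i + suc a′) (+-identityʳ j) ⟨
      f (j + 0) + suc a′      ≡⟨ cong (_+ suc a′) (+-identityʳ (f (j + 0))) ⟨
      f (j + 0) + 0 + suc a′  ∎
      where open ≡-Reasoning

    module S k = Staircase (suc a′) b (P k) (P-mono k) (P-short k)

    S-spans : ∀ i j → ∃ λ (k : Fin c) → Link (S.staircase (toℕ k)) (inj₁ i) (inj₂ j)
    S-spans i j
      with r , lo , hi , eq ← residue-exists (suc a′) (P 0 (toℕ j)) (toℕ i) (toℕ<n i)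
      with k , k<c , lo′ , hi′ ← stepAt (λ k → P k (toℕ j)) c lo
                                   (subst (r <_) (sym (P-period (toℕ j))) hi) =
      fromℕ< k<c , subst (λ k → Link (S.staircase k) (inj₁ i) (inj₂ j)) (sym (toℕ-fromℕ< k<c))
        -- The next forest starts column `j` at `P (suc k) j`, which is `suc (P k (suc j))`; the
        -- strict bound thus becomes the inclusive end of the column in forest `k`.
        (S.staircase-link k i j eq lo′ (s≤s⁻¹ (begin
          suc r                              ≤⟨ hi′ ⟩
          f (toℕ j + suc k) + suc k          ≡⟨ cong (λ t → f t + suc k) (+-suc (toℕ j) k) ⟩
          f (suc (toℕ j + k)) + suc k        ≡⟨ +-suc _ k ⟩
          suc (f (suc (toℕ j + k)) + k)      ∎)))
      where open ≤-Reasoning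

  staircaseCover : ForestCover (Across {Fin (suc a′)} {Fin b}) c
  staircaseCover = record
    { forest = λ k → S.staircase (toℕ k)
    ; within = λ k → S.staircase-across (toℕ k)
    ; spans  = λ {u} {v} → across-spans u v
    }
    where
    across-spans : ∀ u v → Across u v → ∃ λ (k : Fin c) → Link (S.staircase (toℕ k)) u v
    across-spans (inj₁ i) (inj₂ j) _ = S-spans i j
    across-spans (inj₂ j) (inj₁ i) _ = let (k , link) = S-spans i j in k , Sum.swap link

-- For `e = suc a′ ∸ c`, subtracting `c * b` from both sides of the edge count yields the bound on
-- the rise.
completeBipartiteCover : ∀ a′ b c .{{_ : NonZero c}} → c ≤ suc a′ → suc a′ * b ≤ c * (a′ + b) →
                         ForestCover (Across {Fin (suc a′)} {Fin b}) c
completeBipartiteCover a′ b c c≤a enough =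
  staircaseCover a′ (suc a′ ∸ c) c b (sym (m∸n+n≡m c≤a)) (begin
    b * (suc a′ ∸ c)       ≡⟨ *-distribˡ-∸ b (suc a′) c ⟩
    b * suc a′ ∸ b * c     ≡⟨ cong₂ _∸_ (*-comm b (suc a′)) (*-comm b c) ⟩
    suc a′ * b ∸ c * b     ≤⟨ ∸-monoˡ-≤ (c * b) enough ⟩
    c * (a′ + b) ∸ c * b   ≡⟨ *-distribˡ-∸ c (a′ + b) b ⟨
    c * (a′ + b ∸ b)       ≡⟨ cong (c *_) (m+n∸n≡m a′ b) ⟩
    c * a′                 ≡⟨ *-comm c a′ ⟩
    a′ * c                 ∎)
  where open ≤-Reasoning

-- Covering the join by forests

_⊎ᶠ_ : {V W : Set} → Forest V → Forest W → Forest (V ⊎ W)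
F₁ ⊎ᶠ F₂ = record
  { parent   = Sum.map (parent F₁) (parent F₂)
  ; rank     = Sum.[ rank F₁ , rank F₂ ]
  ; descends = λ where
      (inj₁ v) pv≢v → descends F₁ v (pv≢v ∘ cong inj₁)
      (inj₂ w) pw≢w → descends F₂ w (pw≢w ∘ cong inj₂)
  }

-- Pads a list of `suc m` forests to length `k` by repeating the last one.
clamp : ∀ {m k} → Fin k → Fin (suc m)
clamp {zero}          _           = Fin.zero
clamp {suc m} {suc k} Fin.zero    = Fin.zero
clamp {suc m} {suc k} (Fin.suc i) = Fin.suc (clamp i)

clamp-surjective : ∀ {m k} → suc m ≤ k → ∀ (j : Fin (suc m)) → ∃ λ (i : Fin k) → clamp i ≡ j
clamp-surjective {zero}  {suc k} _       Fin.zero    = Fin.zero , refl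
clamp-surjective {suc m} {suc k} _       Fin.zero    = Fin.zero , refl
clamp-surjective {suc m} {suc k} (s≤s l) (Fin.suc j) with i , refl ← clamp-surjective l j =
  Fin.suc i , refl

-- The edges inside the two factors share the first `k` forests, as disjoint unions; the last `c`
-- forests take the cross edges.
joinCover : (G₁ : Graph n₁) (G₂ : Graph n₂) → ∀ {m₁ m₂ k c} → suc m₁ ≤ k → suc m₂ ≤ k →
            ForestCover (Adj G₁) (suc m₁) → ForestCover (Adj G₂) (suc m₂) →
            ForestCover (Across {Fin n₁} {Fin n₂}) c → ForestCover (Adj (G₁ ✶ G₂)) (k + c)
joinCover {n₁} {n₂} G₁ G₂ {m₁} {m₂} {k} {c} m₁<k m₂<k c₁ c₂ cˣ =
  transportCover (splitAt n₁) (join n₁ n₂) (splitAt-join n₁ n₂) (join-splitAt n₁ n₂) sumCover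
  where
  F : Fin k ⊎ Fin c → Forest (Fin n₁ ⊎ Fin n₂)
  F (inj₁ i) = forest c₁ (clamp i) ⊎ᶠ forest c₂ (clamp i)
  F (inj₂ i) = forest cˣ i

  across⇒join : ∀ u v → Across u v → JoinAdj G₁ G₂ u v
  across⇒join (inj₁ _) (inj₂ _) _ = tt
  across⇒join (inj₂ _) (inj₁ _) _ = tt

  F-within : ∀ i → ParentEdgesIn (JoinAdj G₁ G₂) (F i)
  F-within (inj₁ i) (inj₁ v) pv≢v = within c₁ (clamp i) v (pv≢v ∘ cong inj₁)
  F-within (inj₁ i) (inj₂ v) pv≢v = within c₂ (clamp i) v (pv≢v ∘ cong inj₂)
  F-within (inj₂ i) v pv≢v = across⇒join v _ (within cˣ i v pv≢v)

  F-spans : ∀ u v → JoinAdj G₁ G₂ u v → ∃ λ i → Link (F i) u v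
  F-spans (inj₁ u) (inj₁ v) uv with i , link ← spans c₁ uv
                               with j , refl ← clamp-surjective {k = k} m₁<k i =
    inj₁ j , Sum.map (cong inj₁) (cong inj₁) link
  F-spans (inj₂ u) (inj₂ v) uv with i , link ← spans c₂ uv
                               with j , refl ← clamp-surjective {k = k} m₂<k i =
    inj₁ j , Sum.map (cong inj₂) (cong inj₂) link
  F-spans u@(inj₁ _) v@(inj₂ _) _ = let (i , link) = spans cˣ {u} {v} tt in inj₂ i , link
  F-spans u@(inj₂ _) v@(inj₁ _) _ = let (i , link) = spans cˣ {u} {v} tt in inj₂ i , link

  sumCover : ForestCover (JoinAdj G₁ G₂) (k + c)
  sumCover = record
    { forest = F ∘ splitAt k
    ; within = F-within ∘ splitAt k
    ; spans  = λ {u} {v} uv → let (i , link) = F-spans u v uv in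
        join k c i , subst (λ i → Link (F i) u v) (sym (splitAt-join k c i)) link
    }

-- Two vertices on the same side are joined through a fixed vertex on the other side.
✶-connected : (G₁ : Graph n₁) (G₂ : Graph n₂) → Fin n₁ → Fin n₂ → Connected (G₁ ✶ G₂)
✶-connected {n₁} {n₂} G₁ G₂ u₀ v₀ x y =
  subst₂ (Star (Adj (G₁ ✶ G₂))) (join-splitAt n₁ n₂ x) (join-splitAt n₁ n₂ y)
    (walk (splitAt n₁ x) (splitAt n₁ y))
  where
  cross′ : ∀ u v → Adj (G₁ ✶ G₂) (n₁ ↑ʳ v) (u ↑ˡ n₂)
  cross′ u v = adjSym (G₁ ✶ G₂) {u ↑ˡ n₂} {n₁ ↑ʳ v} (cross G₁ G₂ u v)

  walk : ∀ s t → Star (Adj (G₁ ✶ G₂)) (join n₁ n₂ s) (join n₁ n₂ t)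
  walk (inj₁ u) (inj₁ u′) = cross G₁ G₂ u v₀ ◅ cross′ u′ v₀ ◅ ε
  walk (inj₁ u) (inj₂ v)  = cross G₁ G₂ u v ◅ ε
  walk (inj₂ v) (inj₁ u)  = cross′ u v ◅ ε
  walk (inj₂ v) (inj₂ v′) = cross′ u₀ v ◅ cross G₁ G₂ u₀ v′ ◅ ε

-- Ceilings and the two bounds

⌈/⌉-least : ∀ {x d c} → x ≤ c * d → ⌈ x / d ⌉ ≤ c
⌈/⌉-least {x} {zero}  {c} _    = z≤n
⌈/⌉-least {x} {suc d} {c} x≤cd = s≤s⁻¹ (m<n*o⇒m/o<n (begin-strict
  x + d                <⟨ +-mono-≤-< x≤cd (n<1+n d) ⟩
  c * suc d + suc d    ≡⟨ +-comm _ (suc d) ⟩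
  suc c * suc d        ∎))
  where open ≤-Reasoning

-- For the divisor `suc d` the remainder is at most `d`, which is absorbed by the `d` added inside
-- the ceiling.
⌈/⌉-enough : ∀ x d .{{_ : NonZero d}} → x ≤ ⌈ x / d ⌉ * d
⌈/⌉-enough x (suc d) = +-cancelʳ-≤ d x _ (begin
  x + d                            ≡⟨ m≡m%n+[m/n]*n (x + d) (suc d) ⟩
  (x + d) % suc d + q * suc d      ≤⟨ +-monoˡ-≤ (q * suc d) (s≤s⁻¹ (m%n<n (x + d) (suc d))) ⟩
  d + q * suc d                    ≡⟨ +-comm d _ ⟩
  q * suc d + d                    ∎)
  where
  open ≤-Reasoning
  q = (x + d) / suc d

corollary24 : ∀ {n₁ n₂ : ℕ} (G₁ : Graph n₁) (G₂ : Graph n₂) →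
    Connected G₁ → Connected G₂ → HasEdge G₁ → HasEdge G₂ →
    let B = ⌈ (n₁ * n₂) / (n₁ + n₂ ∸ 1) ⌉ ∸ 1 in
    (gscat (toComplex G₁) ⊔ gscat (toComplex G₂) ⊔ B ≤ gscat (toComplex (G₁ ✶ G₂)))
    × (gscat (toComplex (G₁ ✶ G₂)) ≤ gscat (toComplex G₁) + gscat (toComplex G₂) + B + 1)
corollary24 {suc a} {suc b} G₁ G₂ conn₁ conn₂ (u₀ , _) (v₀ , _) =
  ⊔-lub (⊔-lub lower₁ lower₂) lowerB , upper
  where
  G = G₁ ✶ G₂
  d = a + suc b
  c = ⌈ suc a * suc b / d ⌉
  g₁ = gscat (toComplex G₁)
  g₂ = gscat (toComplex G₂)

  coverG : ForestCover (Adj G) (suc (gscat (toComplex G)))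
  coverG = gscat-forestCover G (u₀ ↑ˡ suc b)

  lower₁ : g₁ ≤ gscat (toComplex G)
  lower₁ = gscat-minimal G₁ u₀ conn₁ (joinCoverˡ G₁ G₂ coverG)

  lower₂ : g₂ ≤ gscat (toComplex G)
  lower₂ = gscat-minimal G₂ v₀ conn₂ (joinCoverʳ G₁ G₂ coverG)

  lowerB : c ∸ 1 ≤ gscat (toComplex G)
  -- The join has `suc d` vertices, so each forest has room for at most `d` cross edges; the
  -- subtraction passes from the number of forests to `gscat`.
  lowerB = ∸-monoˡ-≤ 1 (⌈/⌉-least {d = d} (crossEdges-bound coverG (_↑ˡ suc b) (suc a ↑ʳ_)
    (↑ˡ-injective (suc b) _ _) (↑ʳ-injective (suc a) _ _) ↑ˡ≢↑ʳ (cross G₁ G₂)))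

  instance
    d≢0 : NonZero d
    d≢0 = >-nonZero (m≤n⇒m≤o+n a z<s)

  enough : suc a * suc b ≤ c * d
  enough = ⌈/⌉-enough (suc a * suc b) d

  -- Positivity makes `c ∸ 1` a true predecessor, so that adding 1 again counts all staircases.
  c>0 : 0 < c
  c>0 = n≢0⇒n>0 λ c≡0 → <⇒≱ z<s (subst (λ c → suc a * suc b ≤ c * d) c≡0 enough)

  upper : gscat (toComplex G) ≤ g₁ + g₂ + (c ∸ 1) + 1
  upper = gscat-minimal G (u₀ ↑ˡ suc b) (✶-connected G₁ G₂ u₀ v₀)
    (subst (ForestCover (Adj G)) pieces
      -- `k` has to exceed both `g₁` and `g₂`; the value `suc (g₁ + g₂)` produces the stated total.
      (joinCover G₁ G₂ {k = suc (g₁ + g₂)} (s≤s (m≤m+n g₁ g₂)) (s≤s (m≤n+m g₂ g₁))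
        (gscat-forestCover G₁ u₀) (gscat-forestCover G₂ v₀)
        (completeBipartiteCover a (suc b) c {{>-nonZero c>0}}
          -- Here `c ≤ suc a` because the second factor `suc b` is at most `d`.
          (⌈/⌉-least {d = d} (*-monoʳ-≤ (suc a) (m≤n+m (suc b) a))) enough)))
    where
    pieces : suc (g₁ + g₂) + c ≡ suc (g₁ + g₂ + (c ∸ 1) + 1)
    pieces = cong suc (trans (cong (g₁ + g₂ +_) (sym (m∸n+n≡m c>0)))
                             (sym (+-assoc (g₁ + g₂) (c ∸ 1) 1)))
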